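{- Let $d$ be an integer with $2\leq d\leq 6$. Then for every $n\geq0$, $$w_{d,(d+1)n}=\sum_{k=0}^{(d-1)n}\binom{d^2n-dk}{n+k}\binom{d(n+k)}{(d+1)k}\frac{t^{(d-1)n-2k}}{(d+1)k+1},$$ $$w_{d,(d+1)n+1}=\sum_{k=0}^{(d-1)n}\binom{d^2n+d-dk}{n+k}\binom{d(n+k)}{(d+1)k}\frac{t^{(d-1)n+1-2k}}{dn+1-k},$$ and for every $j$ with $2\leq j\leq d$, $$w_{d,(d+1)n+j}=\sum_{k=0}^{(d-1)n+j-2}\binom{d^2n+d(j-1)-dk}{n+1+k}\binom{dn+d+dk}{(d+1)k+d-j+1}\frac{t^{(d-1)n+j-2-2k}}{(d+1)k+d-j+2}.$$
   Context: For $n\geq0$ let $P_{(d-1)n}$ be a strictly convex polygon with $(d-1)n+2$ vertices and a marked boundary edge $e_*$. A $d$-dissection of it is a decomposition into $n$ non-overlapping convex polygons each having $d+1$ vertices, all among the vertices of $P_{(d-1)n}$. Its checkerboard colouring colours each of these polygons black or white such that the unique polygon containing $e_*$ is black and polygons sharing an edge have different colours; let $n_b,n_w$ be the numbers of black and white polygons. Define $w_{d,n}(t)=\sum t^{n_b-n_w}$, the sum over all $d$-dissections of $P_{(d-1)n}$, with $w_{d,0}=1$. Binomial coefficients $\binom{a}{b}$ are $0$ when $b>a$. -}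

module Defs where

open import Data.Bool using (Bool; true; false; _∧_; _∨_; not; if_then_else_)
open import Data.Nat as ℕ using (ℕ; zero; suc; _+_; _*_; _∸_; _≤ᵇ_; _<ᵇ_; _≡ᵇ_)
open import Data.Nat.Combinatorics using (_C_)
open import Data.Fin using (Fin; toℕ)
open import Data.Vec as Vec using (Vec; []; _∷_; lookup)
open import Data.List as List using (List; []; _∷_; [_]; filter; length; concatMap; upTo; allFin; foldr)
open import Data.Bool.ListAction using (any; all)
open import Data.Integer as ℤ using (ℤ; +_)
open import Data.Rational as ℚ using (ℚ; 0ℚ; 1ℚ)
open import Relation.Nullary.Decidable using (⌊_⌋)
open import Relation.Binary.PropositionalEquality using (_≡_; refl)
open import Relation.Nullary using (Dec; yes; no)
open import Relation.Nullary.Decidable using (T?)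
open import Data.Empty using (⊥)
open import Data.Product using (_×_; proj₁; proj₂)

-- Laurent polynomials in t with rational coefficients, represented by
-- their coefficient functions  (e ↦ coefficient of t^e).

Laurent : Set
Laurent = ℤ → ℚ

0L : Laurent
0L _ = 0ℚ

_⊕_ : Laurent → Laurent → Laurent
(f ⊕ g) e = f e ℚ.+ g e

mono : ℚ → ℤ → Laurent
mono c k e = if ⌊ e ℤ.≟ k ⌋ then c else 0ℚ

ΣL : ℕ → (ℕ → Laurent) → Laurent
ΣL K f = foldr (λ k acc → f k ⊕ acc) 0L (upTo (suc K))

vecs : {A : Set} → List A → (m : ℕ) → List (Vec A m)
vecs xs zero    = [ [] ]
vecs xs (suc m) = concatMap (λ x → List.map (x ∷_) (vecs xs m)) xs

countT : {m : ℕ} → Vec Bool m → ℕ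
countT []          = 0
countT (true ∷ v)  = suc (countT v)
countT (false ∷ v) = countT v

-- The polygon P with N vertices labelled 0,1,…,N-1 in cyclic order
-- (vertices are Fin N).  A vertex subset is a Vec Bool N.
-- A cell (convex polygon with d+1 vertices among those of P) is a
-- vertex subset with exactly d+1 elements.

Cell : ℕ → Set
Cell N = Vec Bool N

cells : (d N : ℕ) → List (Cell N)
cells d N = filter (λ c → countT c ℕ.≟ suc d) (vecs (true ∷ false ∷ []) N)

_∈ᶜ_ : {N : ℕ} → Fin N → Cell N → Bool
x ∈ᶜ c = lookup c x

_≤ᶠ_ _<ᶠ_ : {N : ℕ} → Fin N → Fin N → Bool
x ≤ᶠ y = toℕ x ≤ᵇ toℕ y
x <ᶠ y = toℕ x <ᵇ toℕ y

-- SepBy i j A B : the chord from vertex i to vertex j (i ≤ j) separates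
-- A and B, i.e. A lies in the closed arc i,i+1,…,j and B in the closed
-- complementary arc j,j+1,…,N-1,0,…,i.
SepBy : {N : ℕ} → Fin N → Fin N → Cell N → Cell N → Bool
SepBy {N} i j A B =
  (i ≤ᶠ j) ∧
  all (λ x → not (x ∈ᶜ A) ∨ ((i ≤ᶠ x) ∧ (x ≤ᶠ j))) (allFin N) ∧
  all (λ x → not (x ∈ᶜ B) ∨ ((x ≤ᶠ i) ∨ (j ≤ᶠ x))) (allFin N)

-- A and B are non-overlapping (their convex hulls have disjoint
-- interiors): some chord of P separates them.
nonOverlap : {N : ℕ} → Cell N → Cell N → Bool
nonOverlap {N} A B =
  any (λ i → any (λ j → SepBy i j A B ∨ SepBy i j B A) (allFin N)) (allFin N)

-- {a,b} (a < b) is an edge of the convex polygon with vertex set c: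
-- both are vertices of c and no vertex of c lies strictly between them
-- on one of the two arcs of the boundary.
isEdge : {N : ℕ} → Cell N → Fin N → Fin N → Bool
isEdge {N} c a b =
  (a <ᶠ b) ∧ (a ∈ᶜ c) ∧ (b ∈ᶜ c) ∧
  ( all (λ x → not (x ∈ᶜ c) ∨ not ((a <ᶠ x) ∧ (x <ᶠ b))) (allFin N)
  ∨ all (λ x → not (x ∈ᶜ c) ∨ ((a ≤ᶠ x) ∧ (x ≤ᶠ b))) (allFin N))

shareEdge : {N : ℕ} → Cell N → Cell N → Bool
shareEdge {N} A B =
  any (λ a → any (λ b → isEdge A a b ∧ isEdge B b a ∨ isEdge A a b ∧ isEdge B a b) (allFin N)) (allFin N)

-- Coloured dissections.  A candidate is an assignment of a status to
-- every possible cell: not used, used & black, used & white.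

data Status : Set where
  absent black white : Status

statuses : List Status
statuses = absent ∷ black ∷ white ∷ []

Candidate : (d N : ℕ) → Set
Candidate d N = Vec Status (length (cells d N))

used : {d N : ℕ} → Candidate d N → List (Cell N × Status)
used {d} {N} v = filter (λ p → notAbsent (proj₂ p)) (List.zip (cells d N) (Vec.toList v))
  where
  notAbsent : (s : Status) → Dec (s ≡ absent → ⊥)
  notAbsent absent = no (λ f → f refl)
  notAbsent black  = yes (λ ())
  notAbsent white  = yes (λ ())

isBlack isWhite : Status → Bool
isBlack black = true
isBlack _     = false
isWhite white = true
isWhite _     = false

sameColour : Status → Status → Bool
sameColour s s' = (isBlack s ∧ isBlack s') ∨ (isWhite s ∧ isWhite s')

allPairs : {A : Set} → (A → A → Bool) → List A → Bool
allPairs P []       = true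
allPairs P (x ∷ xs) = all (P x) xs ∧ allPairs P xs

containsMarked : {N : ℕ} → Cell N → Bool
containsMarked {N} c =
  any (λ a → any (λ b → (toℕ a ≡ᵇ 0) ∧ (toℕ b ≡ᵇ 1) ∧ isEdge c a b) (allFin N)) (allFin N)

-- number of vertices of P_{(d-1)n}
nVert : ℕ → ℕ → ℕ
nVert d n = (d ∸ 1) * n + 2

-- a candidate is a d-dissection of P_{(d-1)n} (n pairwise non-overlapping
-- cells with d+1 vertices each) together with a checkerboard colouring of it
isColouredDissection : (d n : ℕ) → Candidate d (nVert d n) → Bool
isColouredDissection d n v =
  (length L ≡ᵇ n) ∧
  allPairs (λ p q → nonOverlap (proj₁ p) (proj₁ q)) L ∧
  all (λ p → not (containsMarked (proj₁ p)) ∨ isBlack (proj₂ p)) L ∧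
  allPairs (λ p q → not (shareEdge (proj₁ p) (proj₁ q)) ∨ not (sameColour (proj₂ p) (proj₂ q))) L
  where L = used {d} {nVert d n} v

excess : {d N : ℕ} → Candidate d N → ℤ
excess {d} {N} v = (+ length (filter (λ p → T? (isBlack (proj₂ p))) (used {d} {N} v)))
           ℤ.- (+ length (filter (λ p → T? (isWhite (proj₂ p))) (used {d} {N} v)))

-- w_{d,n}(t) = Σ_{d-dissections} t^{n_b - n_w}   (each dissection counted
-- with its unique checkerboard colouring)
w : ℕ → ℕ → Laurent
w d n = foldr (λ v acc → mono 1ℚ (excess {d} {nVert d n} v) ⊕ acc) 0L
              (filter (λ v → T? (isColouredDissection d n v))
                      (vecs statuses (length (cells d (nVert d n)))))

ι : ℕ → ℤ
ι n = + n

rhs₁ : ℕ → ℕ → Laurent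
rhs₁ d n = ΣL ((d ∸ 1) * n) λ k →
  mono ((ι (((d * d * n ∸ d * k) C (n + k)) * ((d * (n + k)) C ((d + 1) * k))) ℚ./ suc ((d + 1) * k)))
       (ι ((d ∸ 1) * n) ℤ.- ι (2 * k))

-- second formula, index (d+1)n+1 ; the denominator dn+1-k is written suc (dn ∸ k)
-- (k ≤ (d-1)n ≤ dn in the range of summation)
rhs₂ : ℕ → ℕ → Laurent
rhs₂ d n = ΣL ((d ∸ 1) * n) λ k →
  mono ((ι (((d * d * n + d ∸ d * k) C (n + k)) * ((d * (n + k)) C ((d + 1) * k))) ℚ./ suc (d * n ∸ k)))
       (ι ((d ∸ 1) * n + 1) ℤ.- ι (2 * k))

-- third formula, index (d+1)n+j with 2 ≤ j ≤ d ; the denominator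
-- (d+1)k+d-j+2 is written suc ((d+1)k + (d ∸ j) + 1)
rhs₃ : ℕ → ℕ → ℕ → Laurent
rhs₃ d n j = ΣL ((d ∸ 1) * n + j ∸ 2) λ k →
  mono ((ι (((d * d * n + d * (j ∸ 1) ∸ d * k) C (n + 1 + k))
            * ((d * n + d + d * k) C ((d + 1) * k + (d ∸ j) + 1))) ℚ./ suc ((d + 1) * k + (d ∸ j) + 1)))
       (ι ((d ∸ 1) * n + j ∸ 2) ℤ.- ι (2 * k))

{-# OPTIONS --safe #-}
module Submission where

-- With B and W the generating functions (u per black cell, v per white cell) of dissections whose base polygon is
-- black or white, removing the base polygon gives B = 1 + u W^d and W = 1 + v B^d, and Lagrange inversion yields
-- a [u^a v^b] B = C(db, a-1) C(da, b).  The three formulas are this identity for a + b = (d+1)n + j, with the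
-- vanishing terms dropped.  The inversion is replaced by an induction: cutting one edge off a row of p black and q
-- white polygons is the recursion [a, b] B^p W^q = [a, b] B^(p-1) W^q + [a-1, b] B^(p-1) W^(q+d), and the closed form
-- of Good's formula satisfies it by Pascal's rule alone.

open import Defs
open import Data.Bool using (Bool; true; false; not; T; _∧_; _∨_; if_then_else_)
open import Data.Bool.ListAction using (any; all)
open import Data.Bool.Properties using (T-∧; T-∨; T-≡; not-¬; ¬-not)
open import Data.Empty using (⊥; ⊥-elim)
open import Data.Fin using (Fin; zero; suc; toℕ; fromℕ<)
open import Data.Fin.Properties using (toℕ<n; toℕ-fromℕ<; toℕ-injective)
open import Data.Integer as ℤ using (ℤ)
import Data.Integer.Properties as ℤ
import Data.Integer.Tactic.RingSolver as ℤSolver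
open import Data.List
  using (List; []; _∷_; _++_; map; length; replicate; take; drop; filter; zip; concatMap; cartesianProductWith; foldr;
         upTo; allFin)
open import Data.List.Membership.Propositional using (_∈_; _∉_; find; lose)
open import Data.List.Membership.Propositional.Properties
  using (∈-map⁺; ∈-map⁻; ∈-++⁺ˡ; ∈-++⁺ʳ; ∈-++⁻; ∈-∃++; ∈-filter⁺; ∈-filter⁻; ∈-cartesianProductWith⁺;
         ∈-allFin; ∈-upTo⁺; ∈-upTo⁻)
open import Data.List.Membership.Propositional.Properties.WithK using (unique∧set⇒bag)
open import Data.List.Properties
  using (take++drop≡id; length-++; length-map; length-replicate; length-take; length-drop; ∷-injective; ++-identityʳ;
         ++-assoc; filter-accept; filter-reject; ≡-dec)
open import Data.List.Relation.Binary.BagAndSetEquality using (∼bag⇒↭)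
open import Data.List.Relation.Binary.Permutation.Propositional
  using (_↭_; ↭-refl; ↭-sym; ↭-trans; ↭-reflexive; prep; ↭⇒↭ₛ; module PermutationReasoning)
open import Data.List.Relation.Binary.Permutation.Propositional.Properties
  using (All-resp-↭; ∈-resp-↭; ↭-length; filter-↭; shift; ++⁺ˡ; ++⁺ʳ)
import Data.List.Relation.Binary.Permutation.Setoid.Properties as PermutationSetoid
open import Data.List.Relation.Unary.All as All using (All; []; _∷_)
import Data.List.Relation.Unary.All.Properties as All
open import Data.List.Relation.Unary.AllPairs as AllPairs using (AllPairs; []; _∷_)
import Data.List.Relation.Unary.AllPairs.Properties as AllPairs
open import Data.List.Relation.Unary.Any using (Any; here; there; any?)
open import Data.List.Relation.Unary.Any.Properties using (any⁺; any⁻)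
open import Data.List.Relation.Unary.Unique.Propositional using (Unique)
import Data.List.Relation.Unary.Unique.Propositional.Properties as Unique
open import Data.Nat
open import Data.Nat.Combinatorics using (_C_; nCk+nC[k+1]≡[n+1]C[k+1]; k>n⇒nCk≡0; nCk≡nC[n∸k]; nCn≡1)
open import Data.Nat.Properties
open import Data.List.Membership.DecPropositional _≟_ using (_∈?_)
open import Data.Nat.Tactic.RingSolver using (solve-∀)
open import Data.Product using (Σ; ∃; ∃₂; _×_; _,_; proj₁; proj₂)
open import Data.Rational as ℚ using (ℚ; 0ℚ; 1ℚ)
import Data.Rational.Properties as ℚ
open import Data.Rational.Unnormalised as ℚᵘ using (mkℚᵘ; *≡*)
import Data.Rational.Unnormalised.Properties as ℚᵘ
open import Data.Sum using (_⊎_; inj₁; inj₂; swap; [_,_]′)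
open import Data.Unit using (⊤)
open import Data.Vec as Vec using (Vec; []; _∷_; lookup)
import Data.Vec.Properties as Vec
open import Function using (_∘_; _on_; Equivalence; mk⇔)
open import Relation.Binary.Definitions using (Symmetric; tri<; tri≈; tri>)
open import Relation.Binary.PropositionalEquality
open import Relation.Nullary using (¬_; Dec; yes; no)
open import Relation.Nullary.Decidable using (T?; ⌊_⌋; toWitness; fromWitness; _×-dec_; _⊎-dec_; ¬?)
open import Relation.Unary using (Decidable)
open Equivalence using (to; from)

-- Lists, permutations and booleans

-- The harder half is the passage from the definition to trees. A dissection is given as n pairwise
-- non-overlapping vertex sets of the right size; that they cover the polygon, or that one of them
-- rests on the marked edge, is not part of the data. Both follow from an extremal count: over an
-- interval from x to y at most (y - x - 1) / (d - 1) cells fit, and the polygon has just the size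
-- for which n cells attain this bound. If cells are present but none joins the two ends of an
-- interval, some vertex divides it without cutting a cell, and two intervals in place of one cost a
-- further edge in the bound. So a full interval longer than one edge has a root cell, and each of
-- its d gaps is full again. The circle is cut open at the marked edge, which turns vertices into
-- the numbers 0 to M and arcs into intervals. The induction runs over rows of trees because
-- removing a root leaves a row; hence all the powers B^p W^q enter, although only B itself is
-- wanted.

length-map-++-map : {A B C : Set} {f : A → C} {g : B → C} (xs : List A) (ys : List B) →
                    length (map f xs ++ map g ys) ≡ length xs + length ys
length-map-++-map {f = f} {g} xs ys =
  trans (length-++ (map f xs)) (cong₂ _+_ (length-map f xs) (length-map g ys))

AllPairs-resp-↭ : {A : Set} {R : A → A → Set} → Symmetric R → ∀ {xs ys} → xs ↭ ys → AllPairs R xs → AllPairs R ys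
AllPairs-resp-↭ {A} {R} sym-R p = PermutationSetoid.AllPairs-resp-↭ (setoid A) sym-R
  ((λ where refl r → r) , (λ where refl r → r)) (↭⇒↭ₛ p)

AllPairs-lookup : {A : Set} {R : A → A → Set} → Symmetric R → ∀ {xs} → AllPairs R xs →
                  ∀ {x y} → x ∈ xs → y ∈ xs → x ≡ y ⊎ R x y
AllPairs-lookup sym-R (r ∷ rs) (here refl) (here refl) = inj₁ refl
AllPairs-lookup sym-R (r ∷ rs) (here refl) (there y∈)  = inj₂ (All.lookup r y∈)
AllPairs-lookup sym-R (r ∷ rs) (there x∈)  (here refl) = inj₂ (sym-R (All.lookup r x∈))
AllPairs-lookup sym-R (r ∷ rs) (there x∈)  (there y∈)  = AllPairs-lookup sym-R rs x∈ y∈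

↭-filter : {A : Set} {P : A → Set} (P? : Decidable P) (xs : List A) → xs ↭ filter P? xs ++ filter (¬? ∘ P?) xs
↭-filter P? [] = ↭-refl
↭-filter P? (x ∷ xs) with P? x
... | yes _ = prep x (↭-filter P? xs)
... | no  _ = ↭-trans (prep x (↭-filter P? xs)) (↭-sym (shift x (filter P? xs) _))

least : {P : ℕ → Set} → Decidable P → ∀ k lo → P (lo + k) →
        ∃ λ n → lo ≤ n × n ≤ lo + k × P n × (∀ j → lo ≤ j → j < n → ¬ P j)
least P? k lo p with P? lo
... | yes q = lo , ≤-refl , m≤m+n lo k , q , λ j lo≤j j<lo → ⊥-elim (<⇒≱ j<lo lo≤j)
least {P} P? zero lo p | no ¬q = ⊥-elim (¬q (subst P (+-identityʳ lo) p))
least {P} P? (suc k) lo p | no ¬q with least P? k (suc lo) (subst P (+-suc lo k) p)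
... | n , lo<n , n≤ , q , below = n , <⇒≤ lo<n , subst (n ≤_) (sym (+-suc lo k)) n≤ , q , below′
  where
  below′ : ∀ j → lo ≤ j → j < n → ¬ P j
  below′ j lo≤j j<n with m≤n⇒m<n∨m≡n lo≤j
  ... | inj₁ lo<j = below j lo<j j<n
  ... | inj₂ refl = ¬q

take-drop-++ : ∀ {A : Set} n (ys : List A) {zs} → length ys ≡ n → take n (ys ++ zs) ≡ ys × drop n (ys ++ zs) ≡ zs
take-drop-++ .0 []       refl = refl , refl
take-drop-++ ._ (y ∷ ys) refl with p , q ← take-drop-++ (length ys) ys refl = cong (y ∷_) p , q

-- Reduces equality of counts to membership in both directions; the number of dissections is
-- compared with the number of codes in this way.
same-members⇒↭ : {A : Set} {xs ys : List A} → Unique xs → Unique ys →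
                 (∀ {z} → z ∈ xs → z ∈ ys) → (∀ {z} → z ∈ ys → z ∈ xs) → xs ↭ ys
same-members⇒↭ u v f g = ∼bag⇒↭ (unique∧set⇒bag u v (mk⇔ f g))

vecs-suc : {A : Set} (xs : List A) (k : ℕ) → vecs xs (suc k) ≡ cartesianProductWith _∷_ xs (vecs xs k)
vecs-suc xs k = go xs
  where
  go : ∀ ys → concatMap (λ y → map (y ∷_) (vecs xs k)) ys ≡ cartesianProductWith _∷_ ys (vecs xs k)
  go []       = refl
  go (y ∷ ys) = cong (map (y ∷_) (vecs xs k) ++_) (go ys)

vecs-unique : {A : Set} {xs : List A} → Unique xs → ∀ k → Unique (vecs xs k)
vecs-unique u zero = [] ∷ []
vecs-unique {xs = xs} u (suc k) = subst Unique (sym (vecs-suc xs k))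
  (Unique.cartesianProductWith⁺ _∷_ Vec.∷-injective u (vecs-unique u k))

∈-vecs : {A : Set} {xs : List A} → (∀ x → x ∈ xs) → ∀ {k} (v : Vec A k) → v ∈ vecs xs k
∈-vecs f [] = here refl
∈-vecs {xs = xs} f {suc k} (x ∷ v) = subst (x ∷ v ∈_) (sym (vecs-suc xs k)) (∈-cartesianProductWith⁺ _∷_ (f x) (∈-vecs f v))

∈-statuses : ∀ s → s ∈ statuses
∈-statuses absent = here refl
∈-statuses black  = there (here refl)
∈-statuses white  = there (there (here refl))

statuses-unique : Unique statuses
statuses-unique = ((λ ()) ∷ (λ ()) ∷ []) ∷ ((λ ()) ∷ []) ∷ [] ∷ []

∈-bools : ∀ b → b ∈ true ∷ false ∷ []
∈-bools true  = here refl
∈-bools false = there (here refl)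

cells-unique : ∀ e N → Unique (cells e N)
cells-unique e N = Unique.filter⁺ (λ c → countT c ≟ suc e) (vecs-unique (((λ ()) ∷ []) ∷ [] ∷ []) N)

∈-cells⁺ : ∀ {e N} (c : Cell N) → countT c ≡ suc e → c ∈ cells e N
∈-cells⁺ {e} c eq = ∈-filter⁺ (λ c → countT c ≟ suc e) (∈-vecs ∈-bools c) eq

∈-cells⁻ : ∀ {e N} {c : Cell N} → c ∈ cells e N → countT c ≡ suc e
∈-cells⁻ {e} {N} c∈ = proj₂ (∈-filter⁻ (λ c → countT c ≟ suc e) {xs = vecs (true ∷ false ∷ []) N} c∈)

allPairs⁺ : {A : Set} (P : A → A → Bool) {xs : List A} → AllPairs (λ x y → T (P x y)) xs → T (allPairs P xs)
allPairs⁺ P [] = _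
allPairs⁺ P (p ∷ ps) = T-∧ .from (All.all⁻ _ p , allPairs⁺ P ps)

allPairs⁻ : {A : Set} (P : A → A → Bool) (xs : List A) → T (allPairs P xs) → AllPairs (λ x y → T (P x y)) xs
allPairs⁻ P [] _ = []
allPairs⁻ P (x ∷ xs) t with p , ps ← T-∧ {all (P x) xs} .to t = All.all⁺ (P x) xs p ∷ allPairs⁻ P xs ps

zip-map : {A B : Set} (f : A → B) (xs : List A) → zip xs (map f xs) ≡ map (λ x → x , f x) xs
zip-map f []       = refl
zip-map f (x ∷ xs) = cong (_ ∷_) (zip-map f xs)

zip-⊆ : {A B : Set} {xs : List A} {ys : List B} {p : A × B} → p ∈ zip xs ys → proj₁ p ∈ xs
zip-⊆ {xs = _ ∷ _} {_ ∷ _} (here refl) = here refl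
zip-⊆ {xs = _ ∷ _} {_ ∷ _} (there p∈)  = there (zip-⊆ p∈)

zip-distinct : {A B : Set} {xs : List A} (ys : List B) → Unique xs → AllPairs (_≢_ on proj₁) (zip xs ys)
zip-distinct [] [] = []
zip-distinct (_ ∷ _) [] = []
zip-distinct [] (_ ∷ _) = []
zip-distinct (y ∷ ys) (x∉ ∷ u) = All.tabulate (λ p∈ → All.lookup x∉ (zip-⊆ p∈)) ∷ zip-distinct ys u

map-fromList : {A B : Set} {xs : List A} (v : Vec B (length xs)) (f : A → B) →
               (∀ {x y} → (x , y) ∈ zip xs (Vec.toList v) → y ≡ f x) → v ≡ Vec.map f (Vec.fromList xs)
map-fromList {xs = []}     []      f h = refl
map-fromList {xs = x ∷ xs} (y ∷ v) f h = cong₂ _∷_ (h (here refl)) (map-fromList v f (h ∘ there))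

Unique-map-on : {A B : Set} {f : A → B} {xs : List A} → (∀ {x y} → x ∈ xs → y ∈ xs → f x ≡ f y → x ≡ y) →
                Unique xs → Unique (map f xs)
Unique-map-on inj []       = []
Unique-map-on inj (x∉ ∷ u) =
  All.map⁺ (All.tabulate λ y∈ e → All.lookup x∉ y∈ (inj (here refl) (there y∈) e))
  ∷ Unique-map-on (λ x∈ y∈ → inj (there x∈) (there y∈)) u

difference-injective : ∀ {a b x y} → ℤ.+ a ℤ.- ℤ.+ b ≡ ℤ.+ x ℤ.- ℤ.+ y → a + y ≡ x + b
difference-injective {a} {b} {x} {y} e = ℤ.+-injective (begin
  ℤ.+ a ℤ.+ ℤ.+ y                         ≡⟨ lem (ℤ.+ a) (ℤ.+ b) (ℤ.+ y) ⟩
  (ℤ.+ a ℤ.- ℤ.+ b) ℤ.+ (ℤ.+ b ℤ.+ ℤ.+ y) ≡⟨ cong (ℤ._+ (ℤ.+ b ℤ.+ ℤ.+ y)) e ⟩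
  (ℤ.+ x ℤ.- ℤ.+ y) ℤ.+ (ℤ.+ b ℤ.+ ℤ.+ y) ≡⟨ lem′ (ℤ.+ x) (ℤ.+ y) (ℤ.+ b) ⟨
  ℤ.+ x ℤ.+ ℤ.+ b                         ∎)
  where
  open ≡-Reasoning
  lem : ∀ x y z → x ℤ.+ z ≡ (x ℤ.- y) ℤ.+ (y ℤ.+ z)
  lem = ℤSolver.solve-∀
  lem′ : ∀ x y z → x ℤ.+ z ≡ (x ℤ.- y) ℤ.+ (z ℤ.+ y)
  lem′ = ℤSolver.solve-∀

-- Twice the first number is sum plus difference. Hence, with the number of cells fixed, the
-- exponent of t determines how many of them are black and how many white.
sum-difference-injective : ∀ {a b a′ b′} → a + b ≡ a′ + b′ → ℤ.+ a ℤ.- ℤ.+ b ≡ ℤ.+ a′ ℤ.- ℤ.+ b′ → a ≡ a′ × b ≡ b′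
sum-difference-injective {a} {b} {a′} {b′} s e = a≡a′ , +-cancelˡ-≡ a b b′ (trans s (cong (_+ b′) (sym a≡a′)))
  where
  open ≡-Reasoning
  a≡a′ : a ≡ a′
  a≡a′ = *-cancelˡ-≡ a a′ 2 (+-cancelʳ-≡ (b + b′) (2 * a) (2 * a′) (begin
    2 * a + (b + b′)     ≡⟨ double a b b′ ⟩
    (a + b) + (a + b′)   ≡⟨ cong₂ _+_ s (difference-injective {a} {b} {a′} {b′} e) ⟩
    (a′ + b′) + (a′ + b) ≡⟨ double′ a′ b b′ ⟨
    2 * a′ + (b + b′)    ∎))
    where
    double : ∀ a b c → 2 * a + (b + c) ≡ (a + b) + (a + c)
    double = solve-∀
    double′ : ∀ a b c → 2 * a + (b + c) ≡ (a + c) + (a + b)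
    double′ = solve-∀

T-not⁺ : ∀ {b} → ¬ T b → T (not b)
T-not⁺ {true}  ¬t = ¬t _
T-not⁺ {false} _  = _

T-not⁻ : ∀ {b} → T (not b) → ¬ T b
T-not⁻ {false} _ ()

T-⇒⁺ : ∀ {a b} → (T a → T b) → T (not a ∨ b)
T-⇒⁺ {true}  f = f _
T-⇒⁺ {false} f = _

T-⇒⁻ : ∀ {a b} → T (not a ∨ b) → T a → T b
T-⇒⁻ {true} t _ = t

∃-any⁺ : ∀ {n} (P : Fin n → Bool) i → T (P i) → T (any P (allFin n))
∃-any⁺ P i t = any⁺ P (lose (∈-allFin i) t)

∃-any⁻ : ∀ {n} (P : Fin n → Bool) → T (any P (allFin n)) → ∃ λ i → T (P i)
∃-any⁻ P t with i , _ , Pi ← find (any⁻ P (allFin _) t) = i , Pi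

-- Binomial coefficients and the closed form for forests

nC0≡1 : ∀ n → n C 0 ≡ 1
nC0≡1 n = trans (nCk≡nC[n∸k] {0} {n} z≤n) (nCn≡1 n)

-- The absorption identity, by induction on n from Pascal's rule, so that neither factorials nor
-- division occur.
[1+k]*[1+n]C[1+k] : ∀ n k → suc k * (suc n C suc k) ≡ suc n * (n C k)
[1+k]*[1+n]C[1+k] zero zero = refl
[1+k]*[1+n]C[1+k] zero (suc k)
  rewrite k>n⇒nCk≡0 {1} {suc (suc k)} (s≤s (s≤s z≤n)) | k>n⇒nCk≡0 {0} {suc k} (s≤s z≤n) = *-zeroʳ (suc (suc k))
[1+k]*[1+n]C[1+k] (suc n) zero
  rewrite sym (nCk+nC[k+1]≡[n+1]C[k+1] (suc n) 0) | nC0≡1 (suc n) = cong (1 +_) (begin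
    (suc n C 1) + 0   ≡⟨ [1+k]*[1+n]C[1+k] n 0 ⟩
    suc n * (n C 0)   ≡⟨ cong (suc n *_) (nC0≡1 n) ⟩
    suc n * 1         ∎)
  where open ≡-Reasoning
[1+k]*[1+n]C[1+k] (suc n) (suc k) = begin
  suc (suc k) * (suc (suc n) C suc (suc k))
    ≡⟨ cong (suc (suc k) *_) (nCk+nC[k+1]≡[n+1]C[k+1] (suc n) (suc k)) ⟨
  suc (suc k) * (x + y)
    ≡⟨ regroup k x y ⟩
  x + (suc k * x + suc (suc k) * y)
    ≡⟨ cong (x +_) (cong₂ _+_ ([1+k]*[1+n]C[1+k] n k) ([1+k]*[1+n]C[1+k] n (suc k))) ⟩
  x + (suc n * (n C k) + suc n * (n C suc k))
    ≡⟨ cong (x +_) (*-distribˡ-+ (suc n) (n C k) (n C suc k)) ⟨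
  x + suc n * (n C k + n C suc k)
    ≡⟨ cong (λ z → x + suc n * z) (nCk+nC[k+1]≡[n+1]C[k+1] n k) ⟩
  suc (suc n) * x ∎
  where
  open ≡-Reasoning
  x = suc n C suc k
  y = suc n C suc (suc k)
  regroup : ∀ k x y → suc (suc k) * (x + y) ≡ x + (suc k * x + suc (suc k) * y)
  regroup = solve-∀

nC[k]-sym : ∀ k r → (k + r) C k ≡ (k + r) C r
nC[k]-sym k r = trans (nCk≡nC[n∸k] (m≤m+n k r)) (cong ((k + r) C_) (m+n∸m≡n k r))

-- Both sides are (k + r + 1) times C(k + r, k), by absorption. It exchanges the denominator k + 1
-- for r + 1, the form in which two of the three formulas are stated.
[1+r]*nCk≡[1+k]*nCr : ∀ k r → suc r * ((k + suc r) C k) ≡ suc k * ((k + suc r) C r)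
[1+r]*nCk≡[1+k]*nCr k r = begin
  suc r * ((k + suc r) C k)       ≡⟨ cong (suc r *_) (nC[k]-sym k (suc r)) ⟩
  suc r * ((k + suc r) C suc r)   ≡⟨ cong (λ z → suc r * (z C suc r)) (+-suc k r) ⟩
  suc r * (suc (k + r) C suc r)   ≡⟨ [1+k]*[1+n]C[1+k] (k + r) r ⟩
  suc (k + r) * ((k + r) C r)     ≡⟨ cong (suc (k + r) *_) (nC[k]-sym k r) ⟨
  suc (k + r) * ((k + r) C k)     ≡⟨ [1+k]*[1+n]C[1+k] (k + r) k ⟨
  suc k * (suc (k + r) C suc k)   ≡⟨ cong (λ z → suc k * (z C suc k)) (+-suc′ k r) ⟩
  suc k * ((suc k + r) C suc k)   ≡⟨ cong (suc k *_) (nC[k]-sym (suc k) r) ⟩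
  suc k * ((suc k + r) C r)       ≡⟨ cong (λ z → suc k * (z C r)) (+-suc k r) ⟨
  suc k * ((k + suc r) C r)       ∎
  where
  open ≡-Reasoning
  +-suc′ : ∀ k r → suc (k + r) ≡ suc k + r
  +-suc′ _ _ = refl

difference-cong : ∀ a b x y → a + y ≡ x + b → ι a ℤ.- ι b ≡ ι x ℤ.- ι y
difference-cong a b x y h = begin
  ι a ℤ.- ι b                      ≡⟨ lem (ι a) (ι b) (ι y) ⟩
  ι (a + y) ℤ.- (ι b ℤ.+ ι y)      ≡⟨ cong (λ z → ι z ℤ.- (ι b ℤ.+ ι y)) h ⟩
  ι (x + b) ℤ.- (ι b ℤ.+ ι y)      ≡⟨ lem′ (ι x) (ι b) (ι y) ⟩
  ι x ℤ.- ι y                      ∎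
  where
  open ≡-Reasoning
  lem : ∀ a b y → a ℤ.- b ≡ (a ℤ.+ y) ℤ.- (b ℤ.+ y)
  lem = ℤSolver.solve-∀
  lem′ : ∀ x b y → (x ℤ.+ b) ℤ.- (b ℤ.+ y) ≡ x ℤ.- y
  lem′ = ℤSolver.solve-∀

module Count (m : ℕ) where

  open ≡-Reasoning

  D d : ℕ
  D = suc m
  d = suc D

  d*suc : ∀ b → d * suc b ≡ suc (D + d * b)
  d*suc b = *-suc d b

  -- Good's bivariate Lagrange inversion, with the negative term of the determinant moved to the left:
  -- l = [u^a v^b] B^p W^q, where B = 1 + u W^d and W = 1 + v B^d.
  correction : ℕ → ℕ → ℕ → ℕ → ℕ
  correction p q (suc a) (suc b) = d * d * (((p + (D + d * b)) C a) * ((q + (D + d * a)) C b))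
  correction p q _       _       = 0

  -- With x = B - 1 and y = W - 1 the determinant in Good's formula is 1 - d² x y / ((1 + x) (1 +
  -- y)). Its second term lowers both the exponents and the extraction indices by one: `D + d * b`
  -- in `correction` is d (b + 1) - 1 without subtraction.
  ForestCount : ℕ → ℕ → ℕ → ℕ → ℕ → Set
  ForestCount l p q a b = l + correction p q a b ≡ ((p + d * b) C a) * ((q + d * a) C b)

  ForestCount-sym : ∀ {l} p q a b → ForestCount l p q a b → ForestCount l q p b a
  ForestCount-sym {l} p q a b h = trans (cong (l +_) (sym (corr a b))) (trans h (*-comm ((p + d * b) C a) _))
    where
    corr : ∀ a b → correction p q a b ≡ correction q p b a
    corr zero zero = refl
    corr zero (suc b) = refl
    corr (suc a) zero = refl
    corr (suc a) (suc b) = cong (d * d *_) (*-comm ((p + (D + d * b)) C a) _)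

  ForestCount-empty : ForestCount 1 0 0 0 0
  ForestCount-empty = trans (sym (nC0≡1 (d * 0))) (trans (sym (*-identityʳ _)) (cong (((d * 0) C 0) *_) (sym (nC0≡1 (d * 0)))))

  private
    -- The power B^0 W^0 = 1 has no further coefficients, so the two terms of Good's formula must
    -- cancel. Absorption in each binomial of the main term yields d (b + 1) / (a + 1) and d (a + 1)
    -- / (b + 1), whose product is the factor d² of the correction.
    empty-suc : ∀ a b → ForestCount 0 0 0 (suc a) b
    empty-suc a zero rewrite *-zeroʳ m | k>n⇒nCk≡0 {0} {suc a} (s≤s z≤n) = refl
    empty-suc a (suc b) = *-cancelˡ-≡ _ _ (suc a * suc b) (begin
      suc a * suc b * (d * d * (x * y))
        ≡⟨ lem (suc a) (suc b) d x y ⟩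
      (d * suc b * x) * (d * suc a * y)
        ≡⟨ cong₂ _*_ (cong (_* x) (d*suc b)) (cong (_* y) (d*suc a)) ⟩
      (suc (D + d * b) * x) * (suc (D + d * a) * y)
        ≡⟨ cong₂ _*_ ([1+k]*[1+n]C[1+k] (D + d * b) a) ([1+k]*[1+n]C[1+k] (D + d * a) b) ⟨
      (suc a * (suc (D + d * b) C suc a)) * (suc b * (suc (D + d * a) C suc b))
        ≡⟨ cong₂ (λ u v → (suc a * (u C suc a)) * (suc b * (v C suc b))) (d*suc b) (d*suc a) ⟨
      (suc a * ((d * suc b) C suc a)) * (suc b * ((d * suc a) C suc b))
        ≡⟨ *-assoc-swap (suc a) ((d * suc b) C suc a) (suc b) ((d * suc a) C suc b) ⟩
      suc a * suc b * (((d * suc b) C suc a) * ((d * suc a) C suc b)) ∎)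
      where
      x = (D + d * b) C a
      y = (D + d * a) C b
      lem : ∀ a b d x y → a * b * (d * d * (x * y)) ≡ (d * b * x) * (d * a * y)
      lem = solve-∀
      *-assoc-swap : ∀ a x b y → (a * x) * (b * y) ≡ a * b * (x * y)
      *-assoc-swap = solve-∀

  ForestCount-none : ∀ a b → a + b ≢ 0 → ForestCount 0 0 0 a b
  ForestCount-none (suc a) b       _ = empty-suc a b
  ForestCount-none zero    (suc b) _ = ForestCount-sym 0 0 (suc b) zero (empty-suc b zero)
  ForestCount-none zero    zero    h with () ← h refl

  -- With no black cell left, every black edge of the row is a leaf, so their number does not
  -- matter: C(p + d b, 0) = 1 for all p.
  ForestCount-leaf : ∀ {l} p q b → ForestCount l p q 0 b → ForestCount l (suc p) q 0 b
  ForestCount-leaf p q b h rewrite nC0≡1 (p + d * b) | nC0≡1 (suc p + d * b) = h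

  -- The d white edges exposed by a black cell are just what passing from a to a + 1 adds to q + d
  -- a. So both summands share their second binomial, and Pascal's rule merges the first ones. The
  -- same happens separately in the correction term.
  ForestCount-step : ∀ {l l′} p q a b → ForestCount l p q (suc a) b → ForestCount l′ p (d + q) a b →
                     ForestCount (l + l′) (suc p) q (suc a) b
  ForestCount-step {l} {l′} p q a b h h′ = begin
    l + l′ + correction (suc p) q (suc a) b
      ≡⟨ cong (l + l′ +_) (corr a b) ⟨
    l + l′ + (correction p q (suc a) b + correction p (d + q) a b)
      ≡⟨ lem l l′ _ _ ⟩
    (l + correction p q (suc a) b) + (l′ + correction p (d + q) a b)
      ≡⟨ cong₂ _+_ h h′ ⟩
    (X C suc a) * ((q + d * suc a) C b) + (X C a) * ((d + q + d * a) C b)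
      ≡⟨ cong (λ z → (X C suc a) * ((q + d * suc a) C b) + (X C a) * (z C b)) (absorb d q a) ⟩
    (X C suc a) * ((q + d * suc a) C b) + (X C a) * ((q + d * suc a) C b)
      ≡⟨ *-distribʳ-+ ((q + d * suc a) C b) (X C suc a) (X C a) ⟨
    (X C suc a + X C a) * ((q + d * suc a) C b)
      ≡⟨ cong (_* ((q + d * suc a) C b)) (trans (+-comm (X C suc a) _) (nCk+nC[k+1]≡[n+1]C[k+1] X a)) ⟩
    (suc X C suc a) * ((q + d * suc a) C b) ∎
    where
    X = p + d * b
    lem : ∀ l l′ x y → l + l′ + (x + y) ≡ (l + x) + (l′ + y)
    lem = solve-∀
    absorb : ∀ d q a → d + q + d * a ≡ q + d * suc a
    absorb = solve-∀
    corr : ∀ a b → correction p q (suc a) b + correction p (d + q) a b ≡ correction (suc p) q (suc a) b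
    corr zero zero = refl
    corr (suc a) zero = refl
    corr zero (suc b) rewrite nC0≡1 (p + (D + d * b)) | nC0≡1 (suc p + (D + d * b)) = +-identityʳ _
    corr (suc a) (suc b) = begin
      d * d * ((Z C suc a) * Y) + d * d * ((Z C a) * ((d + q + (D + d * a)) C b))
        ≡⟨ cong (λ w → d * d * ((Z C suc a) * Y) + d * d * ((Z C a) * (w C b))) (sh d q D a) ⟩
      d * d * ((Z C suc a) * Y) + d * d * ((Z C a) * Y)
        ≡⟨ fac (d * d) (Z C suc a) (Z C a) Y ⟩
      d * d * ((Z C a + Z C suc a) * Y)
        ≡⟨ cong (λ w → d * d * (w * Y)) (nCk+nC[k+1]≡[n+1]C[k+1] Z a) ⟩
      d * d * ((suc Z C suc a) * Y) ∎
      where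
      Z = p + (D + d * b)
      Y = (q + (D + d * suc a)) C b
      sh : ∀ d q D a → d + q + (D + d * a) ≡ q + (D + d * suc a)
      sh = solve-∀
      fac : ∀ e x y z → e * (x * z) + e * (y * z) ≡ e * ((y + x) * z)
      fac = solve-∀

  -- After multiplication by a + 1, absorption makes the main term (d b + 1) P and the correction d
  -- b P, where P = C(d b, a) C(d (a + 1), b). One copy of P remains.
  ForestCount-tree : ∀ {l} a b → ForestCount l 1 0 (suc a) b →
                     suc a * l ≡ ((d * b) C a) * ((d * suc a) C b)
  ForestCount-tree {l} a zero h = begin
    suc a * l
      ≡⟨ cong (suc a *_) (trans (sym (+-identityʳ l)) h) ⟩
    suc a * ((suc (d * 0) C suc a) * ((d * suc a) C 0))
      ≡⟨ *-assoc (suc a) (suc (d * 0) C suc a) _ ⟨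
    suc a * (suc (d * 0) C suc a) * ((d * suc a) C 0)
      ≡⟨ cong (_* ((d * suc a) C 0)) ([1+k]*[1+n]C[1+k] (d * 0) a) ⟩
    suc (d * 0) * ((d * 0) C a) * ((d * suc a) C 0)
      ≡⟨ cong (λ z → suc z * ((d * 0) C a) * ((d * suc a) C 0)) (*-zeroʳ d) ⟩
    1 * ((d * 0) C a) * ((d * suc a) C 0)
      ≡⟨ cong (_* ((d * suc a) C 0)) (*-identityˡ ((d * 0) C a)) ⟩
    ((d * 0) C a) * ((d * suc a) C 0) ∎
  ForestCount-tree {l} a (suc b) h = +-cancelʳ-≡ (d * suc b * (Y * Z)) _ _ (begin
    suc a * l + d * suc b * (Y * Z)
      ≡⟨ cong (suc a * l +_) (re d (suc b) Y Z) ⟩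
    suc a * l + d * Y * (suc b * Z)
      ≡⟨ cong (λ z → suc a * l + d * Y * z) Zeq ⟩
    suc a * l + d * Y * (d * suc a * W)
      ≡⟨ re₂ (suc a) l d Y W ⟩
    suc a * (l + d * d * (Y * W))
      ≡⟨ cong (λ z → suc a * (l + d * d * ((z C a) * W))) (d*suc b) ⟩
    suc a * (l + d * d * ((suc (D + d * b) C a) * W))
      ≡⟨ cong (suc a *_) h ⟩
    suc a * ((suc (d * suc b) C suc a) * Z)
      ≡⟨ *-assoc (suc a) (suc (d * suc b) C suc a) Z ⟨
    suc a * (suc (d * suc b) C suc a) * Z
      ≡⟨ cong (_* Z) ([1+k]*[1+n]C[1+k] (d * suc b) a) ⟩
    suc (d * suc b) * Y * Z
      ≡⟨ *-assoc (suc (d * suc b)) Y Z ⟩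
    Y * Z + d * suc b * (Y * Z) ∎)
    where
    Y = (d * suc b) C a
    Z = (d * suc a) C suc b
    W = (D + d * a) C b
    Zeq : suc b * Z ≡ d * suc a * W
    Zeq = begin
      suc b * Z ≡⟨ cong (λ z → suc b * (z C suc b)) (d*suc a) ⟩
      suc b * (suc (D + d * a) C suc b) ≡⟨ [1+k]*[1+n]C[1+k] (D + d * a) b ⟩
      suc (D + d * a) * W ≡⟨ cong (_* W) (d*suc a) ⟨
      d * suc a * W ∎
    re : ∀ d b Y Z → d * b * (Y * Z) ≡ d * Y * (b * Z)
    re = solve-∀
    re₂ : ∀ a l d Y W → a * l + d * Y * (d * a * W) ≡ a * (l + d * d * (Y * W))
    re₂ = solve-∀

  ForestCount-tree₀ : ∀ {l} b → ForestCount l 1 0 0 (suc b) → l ≡ 0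
  ForestCount-tree₀ {l} b h = begin
    l     ≡⟨ +-identityʳ l ⟨
    l + 0 ≡⟨ h ⟩
    ((1 + d * suc b) C 0) * ((d * 0) C suc b) ≡⟨ cong (λ z → ((1 + d * suc b) C 0) * (z C suc b)) (*-zeroʳ d) ⟩
    ((1 + d * suc b) C 0) * (0 C suc b) ≡⟨ cong (((1 + d * suc b) C 0) *_) (k>n⇒nCk≡0 {0} {suc b} (s≤s z≤n)) ⟩
    ((1 + d * suc b) C 0) * 0 ≡⟨ *-zeroʳ ((1 + d * suc b) C 0) ⟩
    0 ∎

-- Cells as increasing lists of positions

ColouredCell : Set
ColouredCell = List ℕ × Bool

#black #white : {A : Set} → List (A × Bool) → ℕ
#black L = length (filter (λ p → T? (proj₂ p)) L)
#white L = length (filter (λ p → T? (not (proj₂ p))) L)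

last : ℕ → List ℕ → ℕ
last x []       = x
last x (y ∷ ys) = last y ys

Within : ℕ → ℕ → List ℕ → Set
Within x y = All (λ v → x ≤ v × v ≤ y)

Outside : ℕ → ℕ → List ℕ → Set
Outside x y = All (λ v → v ≤ x ⊎ y ≤ v)

Separated : List ℕ → List ℕ → Set
Separated A B = ∃₂ λ x y → x ≤ y × Within x y A × Outside x y B

NonOverlap : List ℕ → List ℕ → Set
NonOverlap A B = Separated A B ⊎ Separated B A

CommonChord : List ℕ → List ℕ → ℕ → ℕ → Set
CommonChord A B u v = u < v × (u ∈ A × v ∈ A) × (u ∈ B × v ∈ B)

-- Stronger than the checkerboard condition: colours differ whenever two vertices are common,
-- whether or not they span an edge. Cells read from a code satisfy this form, while completeness
-- assumes only `Compatible`. So shared edges need to yield no more than a common chord in one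
-- direction, and need genuine edges only in the other.
StronglyCompatible : ColouredCell → ColouredCell → Set
StronglyCompatible (A , s) (B , t) = NonOverlap A B × (∀ u v → CommonChord A B u v → s ≢ t)

-- The invariant of the cells read from a code: each stays over one base edge of the row, and if it
-- rests on that edge it has the colour which the row prescribes.
data InSlot : ℕ → List ℕ → List Bool → ColouredCell → Set where
  here  : ∀ {x y ys s cs c} → Within x y (proj₁ c) → (x ∈ proj₁ c → y ∈ proj₁ c → proj₂ c ≡ s) →
          InSlot x (y ∷ ys) (s ∷ cs) c
  there : ∀ {x y ys s cs c} → InSlot y ys cs c → InSlot x (y ∷ ys) (s ∷ cs) c

Increasing : List ℕ → Set
Increasing = AllPairs _<_

InSlot-lower : ∀ {x ys cs c} → Increasing (x ∷ ys) → InSlot x ys cs c → All (x ≤_) (proj₁ c)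
InSlot-lower _ (here w _) = All.map proj₁ w
InSlot-lower ((x<y ∷ _) ∷ inc) (there i) = All.map (≤-trans (<⇒≤ x<y)) (InSlot-lower inc i)

last∈ : ∀ x ys → last x ys ∈ x ∷ ys
last∈ x []       = here refl
last∈ x (y ∷ ys) = there (last∈ y ys)

≤last : ∀ {x ys} → Increasing (x ∷ ys) → ∀ {v} → v ∈ x ∷ ys → v ≤ last x ys
≤last {ys = []} _ (here refl) = ≤-refl
≤last {ys = _ ∷ _} ((x<y ∷ _) ∷ inc) (here refl) = ≤-trans (<⇒≤ x<y) (≤last inc (here refl))
≤last {ys = _ ∷ _} (_ ∷ inc) (there v∈) = ≤last inc v∈

head≤ : ∀ {x ys} → Increasing (x ∷ ys) → ∀ {v} → v ∈ x ∷ ys → x ≤ v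
head≤ _ (here refl) = ≤-refl
head≤ (x< ∷ _) (there v∈) = <⇒≤ (All.lookup x< v∈)

Increasing-++ˡ : ∀ xs {ys} → Increasing (xs ++ ys) → Increasing xs
Increasing-++ˡ []       _       = []
Increasing-++ˡ (x ∷ xs) (p ∷ i) = All.++⁻ˡ xs p ∷ Increasing-++ˡ xs i

Increasing-last : ∀ x ys {zs} → Increasing (x ∷ ys ++ zs) → Increasing (last x ys ∷ zs)
Increasing-last x []       i       = i
Increasing-last x (y ∷ ys) (_ ∷ i) = Increasing-last y ys i

split-InSlot : ∀ {x s cs c} ys zs → InSlot x (ys ++ zs) (replicate (length ys) s ++ cs) c →
               InSlot x ys (replicate (length ys) s) c ⊎ InSlot (last x ys) zs cs c
split-InSlot [] zs i = inj₂ i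
split-InSlot (y ∷ ys) zs (here w f) = inj₁ (here w f)
split-InSlot (y ∷ ys) zs (there i) with split-InSlot ys zs i
... | inj₁ j = inj₁ (there j)
... | inj₂ j = inj₂ j

-- A slot with its index forgotten. Since no entry of `xs` lies strictly between them, `lo` and `hi`
-- are consecutive, and the chord joining them separates `c` from the cell with vertices `xs`.
record Gap (xs : List ℕ) (s : Bool) (c : ColouredCell) : Set where
  field
    {lo hi} : ℕ
    lo∈     : lo ∈ xs
    hi∈     : hi ∈ xs
    lo<hi   : lo < hi
    outside : Outside lo hi xs
    within  : Within lo hi (proj₁ c)
    colour  : lo ∈ proj₁ c → hi ∈ proj₁ c → proj₂ c ≡ s

InSlot⇒Gap : ∀ {x ys s c} → Increasing (x ∷ ys) → InSlot x ys (replicate (length ys) s) c → Gap (x ∷ ys) s c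
InSlot⇒Gap {ys = y ∷ ys} (( x<y ∷ _) ∷ inc) (here w f) = record
  { lo∈ = here refl ; hi∈ = there (here refl) ; lo<hi = x<y
  ; outside = inj₁ ≤-refl ∷ All.tabulate (λ v∈ → inj₂ (head≤ inc v∈)) ; within = w ; colour = f }
InSlot⇒Gap {ys = y ∷ ys} ((x<y ∷ _) ∷ inc) (there i) = record
  { lo∈ = there lo∈ ; hi∈ = there hi∈ ; lo<hi = lo<hi
  ; outside = inj₁ (≤-trans (<⇒≤ x<y) (head≤ inc lo∈)) ∷ outside ; within = within ; colour = colour }
  where open Gap (InSlot⇒Gap inc i)

-- The second entry of the list lies strictly between its two ends but not strictly inside any gap,
-- so no single gap reaches from end to end. Therefore no cell behind an edge of the root cell also
-- contains the base edge.
Gap-proper : ∀ {x ys s c} → Increasing (x ∷ ys) → 2 ≤ length ys → Gap (x ∷ ys) s c →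
             x ∈ proj₁ c → last x ys ∈ proj₁ c → ⊥
Gap-proper {ys = y ∷ z ∷ ys} ((x<y ∷ _) ∷ (y<z ∷ _) ∷ inc) _ gap x∈ l∈ with gap .Gap.outside
... | _ ∷ inj₁ y≤lo ∷ _ = <⇒≱ x<y (≤-trans y≤lo (proj₁ (All.lookup (gap .Gap.within) x∈)))
... | _ ∷ inj₂ hi≤y ∷ _ = <⇒≱ (<-≤-trans y<z (≤last inc (here refl)))
                              (≤-trans (proj₂ (All.lookup (gap .Gap.within) l∈)) hi≤y)
Gap-proper {ys = _ ∷ []} _ (s≤s ())

Edge : List ℕ → ℕ → ℕ → Set
Edge A u v = u < v × u ∈ A × v ∈ A × (Outside u v A ⊎ Within u v A)

Compatible : ColouredCell → ColouredCell → Set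
Compatible (A , s) (B , t) = NonOverlap A B × (∀ u v → Edge A u v → Edge B u v → s ≢ t)

Compatible-sym : Symmetric Compatible
Compatible-sym (o , e) = swap o , λ u v a b → e u v b a ∘ sym

SplitBy : ℕ → List ℕ → Set
SplitBy z c = All (_≤ z) c ⊎ All (z ≤_) c

head-last : ∀ {x y c} → Increasing c → Within x y c → x ∈ c → y ∈ c → ∃ λ ys → c ≡ x ∷ ys × last x ys ≡ y
head-last {c = a ∷ ys} inc w x∈ y∈ with refl ← ≤-antisym (head≤ inc x∈) (proj₁ (All.lookup w (here refl))) =
  ys , refl , ≤-antisym (proj₂ (All.lookup w (last∈ a ys))) (≤last inc y∈)

-- Preorder codes of forests of cells

#true #false : List Bool → ℕ
#true []            = 0
#true (true ∷ cs)   = suc (#true cs)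
#true (false ∷ cs)  = #true cs
#false []           = 0
#false (true ∷ cs)  = #false cs
#false (false ∷ cs) = suc (#false cs)

#true-whites : ∀ n cs → #true (replicate n false ++ cs) ≡ #true cs
#true-whites zero    cs = refl
#true-whites (suc n) cs = #true-whites n cs

#false-whites : ∀ n cs → #false (replicate n false ++ cs) ≡ n + #false cs
#false-whites zero    cs = refl
#false-whites (suc n) cs = cong suc (#false-whites n cs)

#true-blacks : ∀ n cs → #true (replicate n true ++ cs) ≡ n + #true cs
#true-blacks zero    cs = refl
#true-blacks (suc n) cs = cong suc (#true-blacks n cs)

#false-blacks : ∀ n cs → #false (replicate n true ++ cs) ≡ #false cs
#false-blacks zero    cs = refl
#false-blacks (suc n) cs = #false-blacks n cs

module Codes (m : ℕ) where

  open Count m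

  -- A code for cs is a row of trees with root colours cs: `leaf` is a boundary edge, and `node` a cell whose
  -- other d edges are put in front of the remaining row.  Reading a code from left to right from the position x,
  -- `ends` are the right endpoints of the base edges and `nodes` the cells.
  data Code : List Bool → Set where
    done : Code []
    leaf : ∀ {s cs} → Code cs → Code (s ∷ cs)
    node : ∀ {s cs} → Code (replicate d (not s) ++ cs) → Code (s ∷ cs)

  -- A node lengthens the row, but it also uses up one of the a black or b white cells, so the
  -- recursion is lexicographic in the cells left and then the row.
  codes : ∀ cs → ℕ → ℕ → List (Code cs)
  codes [] zero zero = done ∷ []
  codes [] _    _    = []
  codes (true ∷ cs) zero b = map leaf (codes cs zero b)
  codes (true ∷ cs) (suc a) b = map leaf (codes cs (suc a) b) ++ map node (codes (replicate d false ++ cs) a b)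
  codes (false ∷ cs) a zero = map leaf (codes cs a zero)
  codes (false ∷ cs) a (suc b) = map leaf (codes cs a (suc b)) ++ map node (codes (replicate d true ++ cs) a b)

  -- The count depends on the row only through its numbers of black and white edges. The white
  -- clauses are the black ones with the colours exchanged by `ForestCount-sym`.
  length-codes : ∀ cs a b → ForestCount (length (codes cs a b)) (#true cs) (#false cs) a b
  length-codes [] zero zero = ForestCount-empty
  length-codes [] zero (suc b) = ForestCount-none zero (suc b) (λ ())
  length-codes [] (suc a) b = ForestCount-none (suc a) b (λ ())
  length-codes (true ∷ cs) zero b =
    subst (λ l → ForestCount l (suc (#true cs)) (#false cs) 0 b) (sym (length-map leaf (codes cs zero b)))
      (ForestCount-leaf (#true cs) (#false cs) b (length-codes cs zero b))
  length-codes (true ∷ cs) (suc a) b =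
    subst (λ l → ForestCount l (suc (#true cs)) (#false cs) (suc a) b)
      (sym (length-map-++-map (codes cs (suc a) b) (codes (replicate d false ++ cs) a b)))
      (ForestCount-step (#true cs) (#false cs) a b (length-codes cs (suc a) b)
        (subst₂ (λ p q → ForestCount (length (codes (replicate d false ++ cs) a b)) p q a b)
          (#true-whites d cs) (#false-whites d cs) (length-codes (replicate d false ++ cs) a b)))
  length-codes (false ∷ cs) a zero =
    subst (λ l → ForestCount l (#true cs) (suc (#false cs)) a 0) (sym (length-map leaf (codes cs a zero)))
      (ForestCount-sym (suc (#false cs)) (#true cs) zero a
        (ForestCount-leaf (#false cs) (#true cs) a
          (ForestCount-sym (#true cs) (#false cs) a zero (length-codes cs a zero))))
  length-codes (false ∷ cs) a (suc b) =
    subst (λ l → ForestCount l (#true cs) (suc (#false cs)) a (suc b))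
      (sym (length-map-++-map (codes cs a (suc b)) (codes (replicate d true ++ cs) a b)))
      (ForestCount-sym (suc (#false cs)) (#true cs) (suc b) a
        (ForestCount-step (#false cs) (#true cs) b a
          (ForestCount-sym (#true cs) (#false cs) a (suc b) (length-codes cs a (suc b)))
          (ForestCount-sym (d + #true cs) (#false cs) a b
            (subst₂ (λ p q → ForestCount (length (codes (replicate d true ++ cs) a b)) p q a b)
              (#true-blacks d cs) (#false-blacks d cs) (length-codes (replicate d true ++ cs) a b)))))

  leaf-injective : ∀ {s cs} {k k′ : Code cs} → leaf {s} k ≡ leaf k′ → k ≡ k′
  leaf-injective refl = refl

  node-injective : ∀ {s cs} {k k′ : Code (replicate d (not s) ++ cs)} → node {s} k ≡ node k′ → k ≡ k′
  node-injective refl = refl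

  leaf≢node : ∀ {s cs} {v : Code (s ∷ cs)} {P : Code cs → Set} {Q : _ → Set} →
              (∃ λ k → P k × v ≡ leaf k) → (∃ λ k → Q k × v ≡ node k) → ⊥
  leaf≢node (_ , _ , refl) (_ , _ , ())

  codes-unique : ∀ cs a b → Unique (codes cs a b)
  codes-unique [] zero zero = [] ∷ []
  codes-unique [] zero (suc b) = []
  codes-unique [] (suc a) b = []
  codes-unique (true ∷ cs) zero b = Unique.map⁺ leaf-injective (codes-unique cs zero b)
  codes-unique (true ∷ cs) (suc a) b =
    Unique.++⁺ (Unique.map⁺ leaf-injective (codes-unique cs (suc a) b))
               (Unique.map⁺ node-injective (codes-unique (replicate d false ++ cs) a b))
               λ where (p , q) → leaf≢node (∈-map⁻ leaf p) (∈-map⁻ node q)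
  codes-unique (false ∷ cs) a zero = Unique.map⁺ leaf-injective (codes-unique cs a zero)
  codes-unique (false ∷ cs) a (suc b) =
    Unique.++⁺ (Unique.map⁺ leaf-injective (codes-unique cs a (suc b)))
               (Unique.map⁺ node-injective (codes-unique (replicate d true ++ cs) a b))
               λ where (p , q) → leaf≢node (∈-map⁻ leaf p) (∈-map⁻ node q)

  ends : ∀ {cs} → Code cs → ℕ → List ℕ
  ends done     x = []
  ends (leaf k) x = suc x ∷ ends k (suc x)
  -- The first d edges of the longer row belong to the new cell; merged, they span its base edge.
  ends (node k) x = last x (take d (ends k x)) ∷ drop d (ends k x)

  nodes : ∀ {cs} → Code cs → ℕ → List ColouredCell
  nodes done         x = []
  nodes (leaf k)     x = nodes k (suc x)
  nodes (node {s} k) x = (x ∷ take d (ends k x) , s) ∷ nodes k x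

  ∈-codes : ∀ {cs} (k : Code cs) x → k ∈ codes cs (#black (nodes k x)) (#white (nodes k x))
  ∈-codes done x = here refl
  ∈-codes (leaf {true} k) x with #black (nodes k (suc x)) | #white (nodes k (suc x)) | ∈-codes k (suc x)
  ... | zero  | _ | h = ∈-map⁺ leaf h
  ... | suc a | _ | h = ∈-++⁺ˡ (∈-map⁺ leaf h)
  ∈-codes (leaf {false} k) x with #black (nodes k (suc x)) | #white (nodes k (suc x)) | ∈-codes k (suc x)
  ... | _ | zero  | h = ∈-map⁺ leaf h
  ... | _ | suc b | h = ∈-++⁺ˡ (∈-map⁺ leaf h)
  ∈-codes (node {true} {cs} k) x = ∈-++⁺ʳ (map leaf (codes cs (suc (#black (nodes k x))) _)) (∈-map⁺ node (∈-codes k x))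
  ∈-codes (node {false} {cs} k) x = ∈-++⁺ʳ (map leaf (codes cs _ (suc (#white (nodes k x))))) (∈-map⁺ node (∈-codes k x))

  codes-count : ∀ {cs} a b {k : Code cs} x → k ∈ codes cs a b → #black (nodes k x) ≡ a × #white (nodes k x) ≡ b
  codes-count {[]} zero zero x (here refl) = refl , refl
  codes-count {true ∷ cs} zero b x h with ∈-map⁻ leaf h
  ... | k , h′ , refl = codes-count zero b (suc x) h′
  codes-count {true ∷ cs} (suc a) b x h with ∈-++⁻ (map leaf (codes cs (suc a) b)) h
  ... | inj₁ h₁ with k , h′ , refl ← ∈-map⁻ leaf h₁ = codes-count (suc a) b (suc x) h′
  ... | inj₂ h₂ with k , h′ , refl ← ∈-map⁻ node h₂ with p , q ← codes-count a b x h′ = cong suc p , q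
  codes-count {false ∷ cs} a zero x h with ∈-map⁻ leaf h
  ... | k , h′ , refl = codes-count a zero (suc x) h′
  codes-count {false ∷ cs} a (suc b) x h with ∈-++⁻ (map leaf (codes cs a (suc b))) h
  ... | inj₁ h₁ with k , h′ , refl ← ∈-map⁻ leaf h₁ = codes-count a (suc b) (suc x) h′
  ... | inj₂ h₂ with k , h′ , refl ← ∈-map⁻ node h₂ with p , q ← codes-count a b x h′ = p , cong suc q

  -- The inductive step in which the cell with vertices x and `ys` is put under d edges of a row.
  -- Here `zs` are the endpoints of the rest of the row and `c` is any cell already placed over the
  -- longer row.
  module Root {x s cs} {ys zs : List ℕ} (inc : Increasing (x ∷ ys ++ zs)) (len : length ys ≡ d) {c : ColouredCell}
              (slot : InSlot x (ys ++ zs) (replicate d (not s) ++ cs) c) where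

    private
      inc-ys : Increasing (x ∷ ys)
      inc-ys = Increasing-++ˡ (x ∷ ys) inc

      y = last x ys

      2≤ : 2 ≤ length ys
      2≤ = subst (2 ≤_) (sym len) (s≤s (s≤s z≤n))

      position : Gap (x ∷ ys) (not s) c ⊎ InSlot y zs cs c
      position with split-InSlot ys zs (subst (λ n → InSlot x (ys ++ zs) (replicate n (not s) ++ cs) c) (sym len) slot)
      ... | inj₁ i = inj₁ (InSlot⇒Gap inc-ys i)
      ... | inj₂ i = inj₂ i

      x<y : x < y
      x<y = lem ys 2≤ inc-ys
        where
        lem : ∀ ys → 2 ≤ length ys → Increasing (x ∷ ys) → x < last x ys
        lem (y ∷ ys) _ ((x<y ∷ _) ∷ inc) = <-≤-trans x<y (≤last inc (here refl))

    merged : InSlot x (y ∷ zs) (s ∷ cs) c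
    merged with position
    ... | inj₁ g = here (All.map (λ (l , h) → ≤-trans (head≤ inc-ys lo∈) l , ≤-trans h (≤last inc-ys hi∈)) within)
                        (λ x∈ y∈ → ⊥-elim (Gap-proper inc-ys 2≤ g x∈ y∈))
      where open Gap g
    ... | inj₂ i = there i

    not-both : ¬ (x ∈ proj₁ c × y ∈ proj₁ c)
    not-both (x∈ , y∈) with position
    ... | inj₁ g = Gap-proper inc-ys 2≤ g x∈ y∈
    ... | inj₂ i = <⇒≱ x<y (All.lookup (InSlot-lower (Increasing-last x ys inc) i) x∈)

    compatible : StronglyCompatible (x ∷ ys , s) c
    compatible with position
    ... | inj₁ g = inj₂ (lo , hi , <⇒≤ lo<hi , within , outside) , chord
      where
      open Gap g
      chord : ∀ u v → CommonChord (x ∷ ys) (proj₁ c) u v → s ≢ proj₂ c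
      chord u v (u<v , (u∈ , v∈) , (u∈c , v∈c)) with All.lookup outside u∈ | All.lookup outside v∈
        | All.lookup within u∈c | All.lookup within v∈c
      ... | inj₂ hi≤u | _ | _ | (_ , v≤hi) = ⊥-elim (<⇒≱ u<v (≤-trans v≤hi hi≤u))
      ... | inj₁ u≤lo | inj₁ v≤lo | (lo≤u , _) | _ = ⊥-elim (<⇒≱ u<v (≤-trans v≤lo lo≤u))
      -- The only chord common to both cells is the gap itself, whose slot carries the colour
      -- opposite to the root.
      ... | inj₁ u≤lo | inj₂ hi≤v | (lo≤u , _) | (_ , v≤hi)
        with refl ← ≤-antisym u≤lo lo≤u | refl ← ≤-antisym v≤hi hi≤v =
        λ s≡t → not-¬ (sym s≡t) (colour u∈c v∈c)
    ... | inj₂ i = inj₁ (x , y , <⇒≤ x<y , All.tabulate (λ v∈ → head≤ inc-ys v∈ , ≤last inc-ys v∈) , All.map inj₂ lower)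
                 , λ u v (u<v , (_ , v∈) , (u∈ , _)) _ → <⇒≱ u<v (≤-trans (≤last inc-ys v∈) (All.lookup lower u∈))
      where
      lower = InSlot-lower (Increasing-last x ys inc) i

  IsCell : List ℕ → Set
  IsCell c = Increasing c × length c ≡ suc d

  ends-increasing : ∀ {cs} (k : Code cs) x → Increasing (x ∷ ends k x)
  length-ends : ∀ {cs} (k : Code cs) x → length (ends k x) ≡ length cs

  length-ends done x = refl
  length-ends (leaf k) x = cong suc (length-ends k (suc x))
  length-ends (node {s} {cs} k) x = cong suc (begin
    length (drop d (ends k x))   ≡⟨ length-drop d (ends k x) ⟩
    length (ends k x) ∸ d        ≡⟨ cong (_∸ d) (length-ends k x) ⟩
    length (replicate d (not s) ++ cs) ∸ d ≡⟨ cong (_∸ d) (length-++ (replicate d (not s))) ⟩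
    length (replicate d (not s)) + length cs ∸ d ≡⟨ cong (λ n → n + length cs ∸ d) (length-replicate d) ⟩
    d + length cs ∸ d            ≡⟨ m+n∸m≡n d (length cs) ⟩
    length cs                    ∎)
    where
    open ≡-Reasoning

  length-take-ends : ∀ {s cs} (k : Code (replicate d s ++ cs)) x → length (take d (ends k x)) ≡ d
  length-take-ends {s} {cs} k x = begin
    length (take d (ends k x)) ≡⟨ length-take d (ends k x) ⟩
    d ⊓ length (ends k x)      ≡⟨ cong (d ⊓_) (length-ends k x) ⟩
    d ⊓ length (replicate d s ++ cs) ≡⟨ cong (d ⊓_) (length-++ (replicate d s)) ⟩
    d ⊓ (length (replicate d s) + length cs) ≡⟨ cong (λ n → d ⊓ (n + length cs)) (length-replicate d) ⟩
    d ⊓ (d + length cs)        ≡⟨ m≤n⇒m⊓n≡m (m≤m+n d (length cs)) ⟩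
    d                          ∎
    where open ≡-Reasoning

  split-ends : ∀ {cs} (k : Code cs) x → Increasing (x ∷ take d (ends k x) ++ drop d (ends k x))
  split-ends k x = subst (λ l → Increasing (x ∷ l)) (sym (take++drop≡id d (ends k x))) (ends-increasing k x)

  ends-increasing done x = [] ∷ []
  ends-increasing (leaf k) x with ih ← ends-increasing k (suc x) =
    (n<1+n x ∷ All.map (<-trans (n<1+n x)) (AllPairs.head ih)) ∷ ih
  ends-increasing (node k) x = lem (take d (ends k x)) (length-take-ends k x) (split-ends k x)
    where
    lem : ∀ ys {zs} → length ys ≡ d → Increasing (x ∷ ys ++ zs) → Increasing (x ∷ last x ys ∷ zs)
    lem (y ∷ ys) _ (x< ∷ i) =
      (All.lookup x< (∈-++⁺ˡ (last∈ y ys)) ∷ All.++⁻ʳ (y ∷ ys) x<) ∷ Increasing-last y ys i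

  nodes-InSlot : ∀ {cs} (k : Code cs) x → All (InSlot x (ends k x) cs) (nodes k x)

  split-slots : ∀ {s cs} (k : Code (replicate d s ++ cs)) x →
                All (InSlot x (take d (ends k x) ++ drop d (ends k x)) (replicate d s ++ cs)) (nodes k x)
  split-slots k x = subst (λ l → All (InSlot x l _) (nodes k x)) (sym (take++drop≡id d (ends k x))) (nodes-InSlot k x)

  root-increasing : ∀ {cs} (k : Code cs) x → Increasing (x ∷ take d (ends k x))
  root-increasing k x = AllPairs.take⁺ (suc d) (ends-increasing k x)

  nodes-InSlot done x = []
  nodes-InSlot (leaf k) x = All.map there (nodes-InSlot k (suc x))
  nodes-InSlot (node k) x =
    here (All.tabulate (λ v∈ → head≤ (root-increasing k x) v∈ , ≤last (root-increasing k x) v∈)) (λ _ _ → refl)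
    ∷ All.map (Root.merged (split-ends k x) (length-take-ends k x)) (split-slots k x)

  nodes-compatible : ∀ {cs} (k : Code cs) x → AllPairs StronglyCompatible (nodes k x)
  nodes-compatible done x = []
  nodes-compatible (leaf k) x = nodes-compatible k (suc x)
  nodes-compatible (node k) x =
    All.map (Root.compatible (split-ends k x) (length-take-ends k x)) (split-slots k x) ∷ nodes-compatible k x

  nodes-IsCell : ∀ {cs} (k : Code cs) x → All (IsCell ∘ proj₁) (nodes k x)
  nodes-IsCell done x = []
  nodes-IsCell (leaf k) x = nodes-IsCell k (suc x)
  nodes-IsCell (node k) x = (root-increasing k x , cong suc (length-take-ends k x)) ∷ nodes-IsCell k x

  -- A leaf spans one boundary edge, and a cell replaces one edge of the row by d, thereby adding D
  -- = d - 1.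
  last-ends : ∀ {cs} (k : Code cs) x → last x (ends k x) ≡ x + (length cs + D * length (nodes k x))
  last-ends done x = sym (trans (cong (x +_) (*-zeroʳ D)) (+-identityʳ x))
  last-ends (leaf {cs = cs} k) x = trans (last-ends k (suc x)) (sym (+-suc x _))
  last-ends (node {s} {cs} k) x = begin
    last (last x (take d (ends k x))) (drop d (ends k x)) ≡⟨ last-++ x (take d (ends k x)) ⟨
    last x (take d (ends k x) ++ drop d (ends k x)) ≡⟨ cong (last x) (take++drop≡id d (ends k x)) ⟩
    last x (ends k x) ≡⟨ last-ends k x ⟩
    x + (length (replicate d (not s) ++ cs) + D * n)
      ≡⟨ cong (λ l → x + (l + D * n)) (trans (length-++ (replicate d (not s))) (cong (_+ length cs) (length-replicate d))) ⟩
    x + (suc D + length cs + D * n) ≡⟨ lem x D (length cs) n ⟩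
    x + (suc (length cs) + D * suc n) ∎
    where
    open ≡-Reasoning
    n = length (nodes k x)
    last-++ : ∀ x ys {zs} → last x (ys ++ zs) ≡ last (last x ys) zs
    last-++ x [] = refl
    last-++ x (y ∷ ys) = last-++ y ys
    lem : ∀ x D l n → x + (suc D + l + D * n) ≡ x + (suc l + D * suc n)
    lem = solve-∀

  leaf-avoids-start : ∀ {cs} (k : Code cs) x {c} → c ∈ nodes k (suc x) → x ∉ proj₁ c
  leaf-avoids-start k x c∈ x∈ =
    1+n≰n (All.lookup (InSlot-lower (ends-increasing k (suc x)) (All.lookup (nodes-InSlot k (suc x)) c∈)) x∈)

  -- The first constructor is visible in the cells: x is a vertex of some cell after a node and of
  -- none after a leaf. For two nodes the common base edge identifies the root, because no other
  -- cell of the code contains both of its ends; the root can then be struck from both lists.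
  nodes-injective : ∀ {cs} (k k′ : Code cs) x → ends k x ≡ ends k′ x →
                    (∀ {c} → c ∈ nodes k x → c ∈ nodes k′ x) → (∀ {c} → c ∈ nodes k′ x → c ∈ nodes k x) → k ≡ k′
  nodes-injective done done x _ _ _ = refl
  nodes-injective (leaf k) (leaf k′) x e f g = cong leaf (nodes-injective k k′ (suc x) (proj₂ (∷-injective e)) f g)
  nodes-injective (leaf k) (node k′) x e f g =
    ⊥-elim (leaf-avoids-start k x (g (here refl)) (here refl))
  nodes-injective (node k) (leaf k′) x e f g =
    ⊥-elim (leaf-avoids-start k′ x (f (here refl)) (here refl))
  nodes-injective (node k) (node k′) x e f g =
    cong node (nodes-injective k k′ x inner (strip k k′ (sym root) f) (strip k′ k root g))
    where
    e₁ = proj₁ (∷-injective e)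
    e₂ = proj₂ (∷-injective e)
    not-both : ∀ {s cs} (k : Code (replicate d (not s) ++ cs)) {c} → c ∈ nodes k x →
               ¬ (x ∈ proj₁ c × last x (take d (ends k x)) ∈ proj₁ c)
    not-both {s} k c∈ = Root.not-both {s = s} {ys = take d (ends k x)} (split-ends k x) (length-take-ends k x)
                                      (All.lookup (split-slots k x) c∈)
    root : take d (ends k x) ≡ take d (ends k′ x)
    root with f (here refl)
    ... | here q = proj₂ (∷-injective (cong proj₁ q))
    ... | there q = ⊥-elim (not-both k′ q (here refl , subst (_∈ x ∷ take d (ends k x)) e₁ (last∈ x _)))
    inner : ends k x ≡ ends k′ x
    inner = trans (sym (take++drop≡id d (ends k x))) (trans (cong₂ _++_ root e₂) (take++drop≡id d (ends k′ x)))
    strip : ∀ {s cs} (k k′ : Code (replicate d (not s) ++ cs)) → take d (ends k′ x) ≡ take d (ends k x) →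
            (∀ {c} → c ∈ nodes (node {s} k) x → c ∈ nodes (node {s} k′) x) → ∀ {c} → c ∈ nodes k x → c ∈ nodes k′ x
    strip k k′ r f c∈ with f (there c∈)
    ... | there q = q
    ... | here refl = ⊥-elim (not-both k c∈ (here refl , subst (λ l → last x l ∈ x ∷ take d (ends k′ x)) r (last∈ x _)))

-- Every dissection comes from a code

-- If a bound composed of two parts is attained, each part is attained. Fullness of an interval
-- passes to its pieces in this way.
squeeze : ∀ {a b z l} → a ≤ z → z + b ≤ l → a + b ≡ l → a ≡ z × z + b ≡ l
squeeze {a} {b} {z} a≤z zb≤l refl with refl ← ≤-antisym a≤z (+-cancelʳ-≤ b z a zb≤l) = refl , refl

module Completeness (m : ℕ) where

  open Count m
  open Codes m

  -- As d is at least 2, a cell has three vertices or more, and the second one is strictly inside.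
  -- This is what makes non-overlapping a real restriction and keeps an interval of one edge free of
  -- cells.
  cell-interior : ∀ {x y c} → IsCell c → Within x y c → ∃ λ b → b ∈ c × x < b × b < y
  cell-interior {c = a ∷ b ∷ c ∷ _} (((a<b ∷ _) ∷ (b<c ∷ _) ∷ _) , _) ((x≤a , _) ∷ _ ∷ (_ , c≤y) ∷ _) =
    b , there (here refl) , ≤-<-trans x≤a a<b , <-≤-trans b<c c≤y

  record Partial (x y : ℕ) (L : List ColouredCell) : Set where
    field
      isCell     : All (IsCell ∘ proj₁) L
      within     : All (Within x y ∘ proj₁) L
      compatible : AllPairs Compatible L

  RootColour : ℕ → ℕ → Bool → List ColouredCell → Set
  RootColour x y s = All (λ c → Within x y (proj₁ c) → x ∈ proj₁ c → y ∈ proj₁ c → proj₂ c ≡ s)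

  GapColour : ℕ → List ℕ → Bool → List ColouredCell → Set
  GapColour x []       s L = ⊤
  GapColour x (y ∷ ys) s L = RootColour x y s L × GapColour y ys s L

  -- Quantifying over the code k of the rest of the row avoids concatenating codes.
  Fills : ℕ → List ℕ → Bool → List ColouredCell → Set
  Fills x ys s L = ∀ {cs} (k : Code cs) → Σ (Code (replicate (length ys) s ++ cs)) λ k′ →
    ends k′ x ≡ ys ++ ends k (last x ys) × nodes k′ x ↭ L ++ nodes k (last x ys)

  -- A polygon holds at most one cell per D boundary edges beyond its first, and is dissected when it is full.
  record Filling (x : ℕ) (ys : List ℕ) (L : List ColouredCell) : Set where
    field
      bound : x + (length ys + D * length L) ≤ last x ys
      fills : x + (length ys + D * length L) ≡ last x ys → ∀ {s} → GapColour x ys s L → Fills x ys s L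

  IntervalFilling : ℕ → Set
  IntervalFilling n = ∀ x y L → x < y → y ≤ x + n → Partial x y L → Filling x (y ∷ []) L

  GapsAtMost : ℕ → ℕ → List ℕ → Set
  GapsAtMost n x []       = ⊤
  GapsAtMost n x (y ∷ ys) = y ≤ x + n × GapsAtMost n y ys

  gapsAtMost : ∀ n x ys → Increasing (x ∷ ys) → last x ys ≤ x + n → GapsAtMost n x ys
  gapsAtMost n x [] _ _ = _
  gapsAtMost n x (y ∷ ys) ((x<y ∷ _) ∷ inc) l≤ =
    ≤-trans (≤last inc (here refl)) l≤ , gapsAtMost n y ys inc (≤-trans l≤ (+-monoˡ-≤ n (<⇒≤ x<y)))

  RootColour-filter : ∀ {x y s} {P : ColouredCell → Set} (P? : Decidable P) {L} →
                      RootColour x y s L → RootColour x y s (filter P? L)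
  RootColour-filter P? = All.filter⁺ P?

  GapColour-filter : ∀ {x s} ys {P : ColouredCell → Set} (P? : Decidable P) {L} →
                     GapColour x ys s L → GapColour x ys s (filter P? L)
  GapColour-filter []       P? _       = _
  GapColour-filter (y ∷ ys) P? (r , g) = RootColour-filter P? r , GapColour-filter ys P? g

  -- No cell crosses a division point, so filtering at the first one deals the cells out to the
  -- first gap and the remaining ones. The bounds add up, and equality in the sum forces equality in
  -- every gap.
  gap-filling : ∀ n → IntervalFilling n → ∀ x ys L → Increasing (x ∷ ys) → GapsAtMost n x ys →
                Partial x (last x ys) L → All (λ c → All (λ z → SplitBy z (proj₁ c)) ys) L → Filling x ys L
  gap-filling n rec x [] (c ∷ L) _ _ P _ with cell-interior (All.head (P .Partial.isCell)) (All.head (P .Partial.within))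
  ... | _ , _ , x<b , b<x = ⊥-elim (<-asym x<b b<x)
  gap-filling n rec x [] [] _ _ _ _ = record
    { bound = ≤-reflexive (trans (cong (x +_) (*-zeroʳ D)) (+-identityʳ x))
    ; fills = λ _ _ k → k , refl , ↭-refl }
  gap-filling n rec x (z ∷ zs) L ((x<z ∷ x<zs) ∷ inc) (z≤ , small) P split = record
    { bound = subst (_≤ last z zs) sum (≤-trans (+-monoˡ-≤ _ bound₁) bound₂)
    ; fills = λ e {s} (r , g) k →
        let e₁ , e₂ = squeeze bound₁ bound₂ (trans sum e)
            -- The gaps on the right are coded first: the code of the left gap takes them as the
            -- rest of its row.
            k₂ , ends₂ , nodes₂ = F₂ .Filling.fills e₂ {s} (GapColour-filter zs (¬? ∘ below?) g) k
            k₁ , ends₁ , nodes₁ = F₁ .Filling.fills e₁ {s} (RootColour-filter below? r , _) k₂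
        in k₁ , trans ends₁ (cong (z ∷_) ends₂) , (begin
             nodes k₁ x                          ↭⟨ nodes₁ ⟩
             L₁ ++ nodes k₂ z                    ↭⟨ ++⁺ˡ L₁ nodes₂ ⟩
             L₁ ++ (L₂ ++ nodes k (last z zs))   ≡⟨ ++-assoc L₁ L₂ _ ⟨
             (L₁ ++ L₂) ++ nodes k (last z zs)   ↭⟨ ++⁺ʳ _ (↭-filter below? L) ⟨
             L ++ nodes k (last z zs)            ∎) }
    where
    open Partial P
    open PermutationReasoning
    below? : Decidable (λ (c : ColouredCell) → All (_≤ z) (proj₁ c))
    below? c = All.all? (_≤? z) (proj₁ c)
    L₁ = filter below? L
    L₂ = filter (¬? ∘ below?) L
    zipWith′ : ∀ {P Q R : ℕ → Set} {l} → (∀ {v} → P v → Q v → R v) → All P l → All Q l → All R l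
    zipWith′ f ps qs = All.zipWith (λ (p , q) → f p q) (ps , qs)
    F₁ : Filling x (z ∷ []) L₁
    F₁ = rec x z L₁ x<z z≤ record
      { isCell     = All.filter⁺ below? isCell
      ; within     = All.zipWith (λ (w , b) → zipWith′ (λ (l , _) h → l , h) w b)
                                 (All.filter⁺ below? within , All.all-filter below? L)
      ; compatible = AllPairs.filter⁺ below? compatible }
    above : All (λ c → All (z ≤_) (proj₁ c)) L₂
    above = All.zipWith (λ where
        ((inj₁ b ∷ _) , ¬b) → ⊥-elim (¬b b)
        ((inj₂ a ∷ _) , _)  → a)
      (All.filter⁺ (¬? ∘ below?) split , All.all-filter (¬? ∘ below?) L)
    F₂ : Filling z zs L₂
    F₂ = gap-filling n rec z zs L₂ inc small record
      { isCell     = All.filter⁺ (¬? ∘ below?) isCell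
      ; within     = All.zipWith (λ (w , a) → zipWith′ (λ (_ , h) l → l , h) w a)
                                 (All.filter⁺ (¬? ∘ below?) within , above)
      ; compatible = AllPairs.filter⁺ (¬? ∘ below?) compatible }
      (All.map All.tail (All.filter⁺ (¬? ∘ below?) split))
    bound₁ : x + (1 + D * length L₁) ≤ z
    bound₁ = F₁ .Filling.bound
    bound₂ : z + (length zs + D * length L₂) ≤ last z zs
    bound₂ = F₂ .Filling.bound
    sum : x + (1 + D * length L₁) + (length zs + D * length L₂) ≡ x + (suc (length zs) + D * length L)
    sum = trans (lem x D (length L₁) (length zs) (length L₂))
                (cong (λ l → x + (suc (length zs) + D * l)) (sym (trans (↭-length (↭-filter below? L)) (length-++ L₁))))
      where
      lem : ∀ x D a r b → x + (1 + D * a) + (r + D * b) ≡ x + (suc r + D * (a + b))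
      lem = solve-∀

  -- A chord with A on its inner side would enclose x and y, leaving no room for the interior vertex
  -- of B. So the chord encloses B, and every vertex of A is at or beyond one of its ends.
  split-by-root : ∀ {x y A B} → x ∈ A → y ∈ A → IsCell B → Within x y B → NonOverlap A B →
                  ∀ {z} → z ∈ A → SplitBy z B
  split-by-root x∈ y∈ cell w (inj₁ (p , q , _ , wA , oB)) z∈ with cell-interior cell w
  ... | b , b∈ , x<b , b<y with All.lookup oB b∈
  ... | inj₁ b≤p = ⊥-elim (<⇒≱ x<b (≤-trans b≤p (proj₁ (All.lookup wA x∈))))
  ... | inj₂ q≤b = ⊥-elim (<⇒≱ b<y (≤-trans (proj₂ (All.lookup wA y∈)) q≤b))
  split-by-root x∈ y∈ cell w (inj₂ (p , q , _ , wB , oA)) z∈ with All.lookup oA z∈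
  ... | inj₁ z≤p = inj₂ (All.map (λ (p≤b , _) → ≤-trans z≤p p≤b) wB)
  ... | inj₂ q≤z = inj₁ (All.map (λ (_ , b≤q) → ≤-trans b≤q q≤z) wB)

  gapColour : ∀ x ys {s L} → Increasing (x ∷ ys) →
              (∀ {u v} → u < v → u ∈ x ∷ ys → v ∈ x ∷ ys → Outside u v (x ∷ ys) → RootColour u v s L) →
              GapColour x ys s L
  gapColour x []       _ f = _
  gapColour x (y ∷ ys) ((x<y ∷ x<ys) ∷ inc) f =
      f x<y (here refl) (there (here refl)) (inj₁ ≤-refl ∷ All.tabulate (λ v∈ → inj₂ (head≤ inc v∈)))
    , gapColour y ys inc (λ u<v u∈ v∈ out → f u<v (there u∈) (there v∈) (inj₁ (≤-trans (<⇒≤ x<y) (head≤ inc u∈)) ∷ out))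

  -- The cell resting on the base edge is taken out of the list; its d gaps are shorter intervals
  -- that no other cell crosses, so `gap-filling` applies to the remaining cells.
  root-filling : ∀ n → IntervalFilling n → ∀ x y L → x < y → y ≤ x + suc n → Partial x y L →
                 ∀ {c} → c ∈ L → x ∈ proj₁ c → y ∈ proj₁ c → Filling x (y ∷ []) L
  root-filling n rec x y L x<y y≤ P {A , t} c∈ x∈ y∈
    with L₁ , L₂ , refl ← ∈-∃++ c∈
    with p ← shift (A , t) L₁ L₂
    with (incA , lenA) ∷ isCell ← All-resp-↭ p (P .Partial.isCell)
       | withinA ∷ within ← All-resp-↭ p (P .Partial.within)
       | compatibleA ∷ compatible ← AllPairs-resp-↭ Compatible-sym p (P .Partial.compatible)
    with ys , refl , refl ← head-last incA withinA x∈ y∈ = record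
    { bound = subst (_≤ last x ys) sum bound
    ; fills = λ e {s} (r , _) k → fill (trans sum e) s (All.head (All-resp-↭ p r) withinA x∈ y∈) k }
    where
    len : length ys ≡ d
    len = suc-injective lenA
    L′ = L₁ ++ L₂
    -- Since the root has at least two gaps, each of them is shorter than the whole interval, within
    -- reach of the induction hypothesis.
    small : ∀ ys → 1 < length ys → Increasing (x ∷ ys) → last x ys ≤ x + suc n → GapsAtMost n x ys
    small (y ∷ z ∷ ys) _ ((x<y ∷ _) ∷ inc@((y<z ∷ _) ∷ inc′)) l≤ =
      ≤-pred (≤-trans (<-≤-trans y<z (≤last inc′ (here refl))) (≤-trans l≤ (≤-reflexive (+-suc x n)))) ,
      gapsAtMost n y (z ∷ ys) inc (≤-trans l≤ (≤-trans (≤-reflexive (+-suc x n)) (+-monoˡ-≤ n x<y)))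
    small (_ ∷ []) (s≤s ())
    G : Filling x ys L′
    G = gap-filling n rec x ys L′ incA (small ys (subst (1 <_) (sym len) (s≤s (s≤s z≤n))) incA y≤)
          (record { isCell = isCell ; within = within ; compatible = compatible })
          (All.zipWith (λ ((cell , w) , (o , _)) → All.tabulate (λ z∈ → split-by-root x∈ y∈ cell w o (there z∈)))
            (All.zip (isCell , within) , compatibleA))
    open Filling G
    sum : x + (length ys + D * length L′) ≡ x + (1 + D * length (L₁ ++ (x ∷ ys , t) ∷ L₂))
    sum = trans (cong (λ l → x + (l + D * length L′)) len)
          (trans (lem x D (length L′)) (cong (λ l → x + (1 + D * l)) (sym (↭-length p))))
      where
      lem : ∀ x D l → x + (suc D + D * l) ≡ x + (1 + D * suc l)
      lem = solve-∀
    fill : x + (length ys + D * length L′) ≡ last x ys → ∀ s → t ≡ s → Fills x (last x ys ∷ []) s (L₁ ++ (x ∷ ys , t) ∷ L₂)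
    fill e s refl {cs} k = attach len k′ ends′ nodes′
      where
      colours : GapColour x ys (not t) L′
      -- A gap is an edge of the root because the root has no vertex strictly inside it, and an edge
      -- of a cell spanning it because that cell has no vertex beyond it. So the two cells have
      -- different colours.
      colours = gapColour x ys incA λ u<v u∈ v∈ out →
        All.map (λ (_ , edge) w u∈c v∈c →
          ¬-not (edge _ _ (u<v , u∈ , v∈ , inj₁ out) (u<v , u∈c , v∈c , inj₂ w) ∘ sym)) compatibleA
      F = fills e colours k
      k′ = proj₁ F
      ends′ = proj₁ (proj₂ F)
      nodes′ = proj₂ (proj₂ F)
      -- `Fills` speaks of `length ys` edges and `node` of d; generalising the number lets the
      -- equation be matched.
      attach : ∀ {n} → n ≡ d → (k′ : Code (replicate n (not t) ++ cs)) → ends k′ x ≡ ys ++ ends k (last x ys) →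
               nodes k′ x ↭ L′ ++ nodes k (last x ys) →
               Σ (Code (t ∷ cs)) λ k″ → ends k″ x ≡ last x ys ∷ ends k (last x ys) ×
                 nodes k″ x ↭ (L₁ ++ (x ∷ ys , t) ∷ L₂) ++ nodes k (last x ys)
      attach refl k′ ends′ nodes′ with tk , dr ← take-drop-++ d ys {ends k (last x ys)} len =
        node k′ , cong₂ _∷_ (cong (last x) root) (trans (cong (drop d) ends′) dr) , (begin
          (x ∷ take d (ends k′ x) , t) ∷ nodes k′ x        ≡⟨ cong (λ l → (x ∷ l , t) ∷ nodes k′ x) root ⟩
          (x ∷ ys , t) ∷ nodes k′ x                        ↭⟨ prep _ nodes′ ⟩
          ((x ∷ ys , t) ∷ L′) ++ nodes k (last x ys)       ↭⟨ ++⁺ʳ _ p ⟨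
          (L₁ ++ (x ∷ ys , t) ∷ L₂) ++ nodes k (last x ys) ∎)
        where
        open PermutationReasoning
        root : take d (ends k′ x) ≡ ys
        root = trans (cong (take d) ends′) tk

  -- The witness is the least vertex that shares a cell with y, or y − 1 if there is none.
  splitting-vertex : ∀ x y L → suc x < y → Partial x y L → ¬ Any (λ c → x ∈ proj₁ c × y ∈ proj₁ c) L →
                     ∃ λ z → x < z × z < y × All (λ c → SplitBy z (proj₁ c)) L
  splitting-vertex x y L x+1<y P none
    with r , eq ← m≤n⇒∃[o]m+o≡n x+1<y
    with z , x<z , z≤ , Pz , below ← least
           {P = λ z → Any (λ c → z ∈ proj₁ c × y ∈ proj₁ c) L ⊎ suc z ≡ y}
           (λ z → any? (λ c → z ∈? proj₁ c ×-dec y ∈? proj₁ c) L ⊎-dec (suc z ≟ y)) r (suc x) (inj₂ eq)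
    = z , x<z , subst (z <_) eq (s≤s z≤) , All.tabulate split
    where
    open Partial P
    split : ∀ {c} → c ∈ L → SplitBy z (proj₁ c)
    split {B , t} c∈ with y ∈? B
    ... | yes y∈ = inj₂ (All.tabulate lower)
      where
      lower : ∀ {b} → b ∈ B → z ≤ b
      lower {b} b∈ with z ≤? b
      ... | yes z≤b = z≤b
      ... | no z≰b with m≤n⇒m<n∨m≡n (proj₁ (All.lookup (All.lookup within c∈) b∈))
      ...   | inj₁ x<b  = ⊥-elim (below b x<b (≰⇒> z≰b) (inj₁ (lose c∈ (b∈ , y∈))))
      ...   | inj₂ refl = ⊥-elim (none (lose c∈ (b∈ , y∈)))
    ... | no y∉ = go Pz
      where
      upper : ∀ {b} → b ∈ B → b < y
      upper b∈ = ≤∧≢⇒< (proj₂ (All.lookup (All.lookup within c∈) b∈)) λ where refl → y∉ b∈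
      go : Any (λ c → z ∈ proj₁ c × y ∈ proj₁ c) L ⊎ suc z ≡ y → SplitBy z B
      go (inj₂ refl) = inj₁ (All.tabulate (≤-pred ∘ upper))
      -- Now a cell A contains z and y while B misses y. If the chord encloses A, then B lies left
      -- of it, hence left of z, since right of it nothing is below y. If it encloses B, then z is
      -- not strictly inside it.
      go (inj₁ any) with find any
      ... | (A , s) , A∈ , z∈ , y∈ with AllPairs-lookup Compatible-sym compatible A∈ c∈
      ...   | inj₁ refl = ⊥-elim (y∉ y∈)
      ...   | inj₂ (inj₁ (p , q , _ , wA , oB) , _) = inj₁ (All.tabulate λ b∈ →
                [ (λ b≤p → ≤-trans b≤p (proj₁ (All.lookup wA z∈)))
                , (λ q≤b → ⊥-elim (<⇒≱ (upper b∈) (≤-trans (proj₂ (All.lookup wA y∈)) q≤b))) ]′ (All.lookup oB b∈))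
      ...   | inj₂ (inj₂ (p , q , _ , wB , oA) , _) with All.lookup oA z∈
      ...     | inj₁ z≤p = inj₂ (All.map (λ (p≤b , _) → ≤-trans z≤p p≤b) wB)
      ...     | inj₂ q≤z = inj₁ (All.map (λ (_ , b≤q) → ≤-trans b≤q q≤z) wB)

  -- Induction on a bound for the length of the interval. With no cells, only a single edge is full,
  -- and it is a leaf. If some cell joins x and y, it is the root. Otherwise dividing at
  -- `splitting-vertex` gives the bound for a row of two edges, one better than required, so the
  -- interval cannot be full.
  interval-filling : ∀ n → IntervalFilling n
  interval-filling zero x y L x<y y≤ P = ⊥-elim (<⇒≱ x<y (subst (y ≤_) (+-identityʳ x) y≤))
  interval-filling (suc n) x y [] x<y y≤ P = record
    { bound = subst (_≤ y) (sym eq) x<y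
    ; fills = λ e _ k → leaf-fills (trans (sym eq) e) k }
    where
    eq : x + (1 + D * 0) ≡ suc x
    eq = trans (cong (λ z → x + (1 + z)) (*-zeroʳ D)) (+-comm x 1)
    leaf-fills : ∀ {s} → suc x ≡ y → Fills x (y ∷ []) s []
    leaf-fills refl k = leaf k , refl , ↭-refl
  interval-filling (suc n) x y L@(_ ∷ _) x<y y≤ P
    with any? (λ c → x ∈? proj₁ c ×-dec y ∈? proj₁ c) L
  ... | yes any with find any
  ...   | c , c∈ , x∈ , y∈ = root-filling n (interval-filling n) x y L x<y y≤ P c∈ x∈ y∈
  interval-filling (suc n) x y L@(_ ∷ _) x<y y≤ P | no none
    with _ , _ , x<b , b<y ← cell-interior (All.head (P .Partial.isCell)) (All.head (P .Partial.within))
    with z , x<z , z<y , split ← splitting-vertex x y L (≤-<-trans x<b b<y) P none = record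
    { bound = <⇒≤ strict ; fills = λ e → ⊥-elim (<⇒≢ strict e) }
    where
    y≤′ : y ≤ suc x + n
    y≤′ = ≤-trans y≤ (≤-reflexive (+-suc x n))
    G : Filling x (z ∷ y ∷ []) L
    G = gap-filling n (interval-filling n) x (z ∷ y ∷ []) L ((x<z ∷ x<y ∷ []) ∷ (z<y ∷ []) ∷ [] ∷ [])
          (≤-pred (≤-trans z<y y≤′) , ≤-trans y≤′ (+-monoˡ-≤ n x<z) , _)
          P (All.zipWith (λ (sp , w) → sp ∷ inj₁ (All.map proj₂ w) ∷ []) (split , P .Partial.within))
    strict : x + (1 + D * length L) < y
    strict = subst (_≤ y) (+-suc x (1 + D * length L)) (G .Filling.bound)

  code-of : ∀ y L → Partial 0 y L → y ≡ 1 + D * length L → RootColour 0 y true L →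
            Σ (Code (true ∷ [])) λ k → nodes k 0 ↭ L
  code-of y L P refl r with interval-filling y 0 y L (s≤s z≤n) ≤-refl P
  ... | F with F .Filling.fills refl (r , _) done
  ... | k , _ , p = k , subst (nodes k 0 ↭_) (++-identityʳ L) p

  compatible⇒distinct : ∀ {c c′} → IsCell (proj₁ c) → StronglyCompatible c c′ → proj₁ c ≢ proj₁ c′
  compatible⇒distinct {A , s} cell (o , _) refl = [ irrefl , irrefl ]′ o
    where
    irrefl : ¬ Separated A A
    irrefl (p , q , _ , wA , oA) with cell-interior cell wA
    ... | b , b∈ , p<b , b<q = [ <⇒≱ p<b , <⇒≱ b<q ]′ (All.lookup oA b∈)

-- Cells as vertex subsets

module Positions {M : ℕ} where

  -- A rotation by one vertex, which preserves the cyclic order. The base edge then spans the whole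
  -- interval from 0 to M, as the induction on intervals requires.
  pos : Fin (suc M) → ℕ
  pos zero    = M
  pos (suc i) = toℕ i

  pos-injective : ∀ {u v} → pos u ≡ pos v → u ≡ v
  pos-injective {zero}  {zero}  _ = refl
  pos-injective {zero}  {suc j} e = ⊥-elim (<⇒≢ (toℕ<n j) (sym e))
  pos-injective {suc i} {zero}  e = ⊥-elim (<⇒≢ (toℕ<n i) e)
  pos-injective {suc i} {suc j} e = cong suc (toℕ-injective e)

  pos≤M : ∀ v → pos v ≤ M
  pos≤M zero    = ≤-refl
  pos≤M (suc i) = <⇒≤ (toℕ<n i)

  vertex : ∀ {p} → p ≤ M → ∃ λ v → pos v ≡ p
  vertex {p} p≤M with m≤n⇒m<n∨m≡n p≤M
  ... | inj₁ p<M = suc (fromℕ< p<M) , toℕ-fromℕ< p<M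
  ... | inj₂ p≡M = zero , sym p≡M

  trues : ∀ {n} → ℕ → Vec Bool n → List ℕ
  trues k []          = []
  trues k (true ∷ v)  = k ∷ trues (suc k) v
  trues k (false ∷ v) = trues (suc k) v

  -- The marked edge {0, 1} of the polygon becomes the edge {0, M} joining the extreme positions.
  positions : Cell (suc M) → List ℕ
  positions (b ∷ c) = trues 0 c ++ (if b then M ∷ [] else [])

  trues-lower : ∀ {n} k (v : Vec Bool n) → All (k ≤_) (trues k v)
  trues-lower k []          = []
  trues-lower k (true ∷ v)  = ≤-refl ∷ All.map (≤-trans (n≤1+n k)) (trues-lower (suc k) v)
  trues-lower k (false ∷ v) = All.map (≤-trans (n≤1+n k)) (trues-lower (suc k) v)

  trues-increasing : ∀ {n} k (v : Vec Bool n) → Increasing (trues k v)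
  trues-increasing k []          = []
  trues-increasing k (true ∷ v)  = trues-lower (suc k) v ∷ trues-increasing (suc k) v
  trues-increasing k (false ∷ v) = trues-increasing (suc k) v

  length-trues : ∀ {n} k (v : Vec Bool n) → length (trues k v) ≡ countT v
  length-trues k []          = refl
  length-trues k (true ∷ v)  = cong suc (length-trues (suc k) v)
  length-trues k (false ∷ v) = length-trues (suc k) v

  ∈-trues⁺ : ∀ {n} k (v : Vec Bool n) i → T (lookup v i) → k + toℕ i ∈ trues k v
  ∈-trues⁺ k (true ∷ v)  zero    _ = here (+-identityʳ k)
  ∈-trues⁺ k (true ∷ v)  (suc i) t = there (subst (_∈ trues (suc k) v) (sym (+-suc k (toℕ i))) (∈-trues⁺ (suc k) v i t))
  ∈-trues⁺ k (false ∷ v) (suc i) t = subst (_∈ trues (suc k) v) (sym (+-suc k (toℕ i))) (∈-trues⁺ (suc k) v i t)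

  ∈-trues⁻ : ∀ {n} k (v : Vec Bool n) {p} → p ∈ trues k v → ∃ λ i → k + toℕ i ≡ p × T (lookup v i)
  ∈-trues⁻ k (true ∷ v)  (here refl) = zero , +-identityʳ k , _
  ∈-trues⁻ k (true ∷ v)  (there p∈) with i , e , t ← ∈-trues⁻ (suc k) v p∈ = suc i , trans (+-suc k (toℕ i)) e , t
  ∈-trues⁻ k (false ∷ v) p∈         with i , e , t ← ∈-trues⁻ (suc k) v p∈ = suc i , trans (+-suc k (toℕ i)) e , t

  ∈-positions⁺ : ∀ c v → T (v ∈ᶜ c) → pos v ∈ positions c
  ∈-positions⁺ (true ∷ c) zero    _ = ∈-++⁺ʳ (trues 0 c) (here refl)
  ∈-positions⁺ (b ∷ c)    (suc i) t = ∈-++⁺ˡ (∈-trues⁺ 0 c i t)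

  ∈-positions⁻ : ∀ c {p} → p ∈ positions c → ∃ λ v → pos v ≡ p × T (v ∈ᶜ c)
  ∈-positions⁻ (b ∷ c) p∈ with ∈-++⁻ (trues 0 c) p∈
  ... | inj₁ q with i , e , t ← ∈-trues⁻ 0 c q = suc i , e , t
  ∈-positions⁻ (true ∷ c) p∈ | inj₂ (here refl) = zero , refl , _

  ∈ᶜ-of-position : ∀ c {v} → pos v ∈ positions c → T (v ∈ᶜ c)
  ∈ᶜ-of-position c v∈ with u , e , t ← ∈-positions⁻ c v∈ = subst (λ v → T (v ∈ᶜ c)) (pos-injective e) t

  positions-≤M : ∀ c → All (_≤ M) (positions c)
  positions-≤M c = All.tabulate λ p∈ → let v , e , _ = ∈-positions⁻ c p∈ in subst (_≤ M) e (pos≤M v)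

  All-positions⁺ : ∀ c {P : ℕ → Set} → (∀ v → T (v ∈ᶜ c) → P (pos v)) → All P (positions c)
  All-positions⁺ c {P} f = All.tabulate λ p∈ → let v , e , t = ∈-positions⁻ c p∈ in subst P e (f v t)

  All-positions⁻ : ∀ c {P : ℕ → Set} → All P (positions c) → ∀ v → T (v ∈ᶜ c) → P (pos v)
  All-positions⁻ c ps v t = All.lookup ps (∈-positions⁺ c v t)

  positions-increasing : ∀ c → Increasing (positions c)
  positions-increasing (b ∷ c) = AllPairs.++⁺ (trues-increasing 0 c) (tail b)
    (All.tabulate λ p∈ → let i , e , _ = ∈-trues⁻ 0 c p∈ in above b (subst (_< M) e (toℕ<n i)))
    where
    tail : ∀ b → Increasing (if b then M ∷ [] else [])
    tail true  = [] ∷ []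
    tail false = []
    above : ∀ b {p} → p < M → All (p <_) (if b then M ∷ [] else [])
    above true  p<M = p<M ∷ []
    above false _   = []

  length-positions : ∀ c → length (positions c) ≡ countT c
  length-positions (true ∷ c)  = trans (length-++ (trues 0 c)) (trans (+-comm _ 1) (cong suc (length-trues 0 c)))
  length-positions (false ∷ c) = trans (length-++ (trues 0 c)) (trans (+-identityʳ _) (length-trues 0 c))

  Vec-ext : ∀ {n} (c c′ : Vec Bool n) → (∀ v → T (lookup c v) → T (lookup c′ v)) →
            (∀ v → T (lookup c′ v) → T (lookup c v)) → c ≡ c′
  Vec-ext [] [] _ _ = refl
  Vec-ext (a ∷ c) (b ∷ c′) f g = cong₂ _∷_ (ext (f zero) (g zero)) (Vec-ext c c′ (f ∘ suc) (g ∘ suc))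
    where
    ext : ∀ {a b} → (T a → T b) → (T b → T a) → a ≡ b
    ext {true}  {true}  _ _ = refl
    ext {false} {false} _ _ = refl
    ext {true}  {false} f _ = ⊥-elim (f _)
    ext {false} {true}  _ g = ⊥-elim (g _)

  positions-injective : ∀ {c c′} → positions c ≡ positions c′ → c ≡ c′
  positions-injective {c} {c′} e = Vec-ext c c′
    (λ v t → ∈ᶜ-of-position c′ (subst (pos v ∈_) e (∈-positions⁺ c v t)))
    (λ v t → ∈ᶜ-of-position c (subst (pos v ∈_) (sym e) (∈-positions⁺ c′ v t)))

  Increasing-ext : ∀ {xs ys} → Increasing xs → Increasing ys →
                   (∀ {v} → v ∈ xs → v ∈ ys) → (∀ {v} → v ∈ ys → v ∈ xs) → xs ≡ ys
  Increasing-ext {[]} {[]} _ _ _ _ = refl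
  Increasing-ext {[]} {_ ∷ _} _ _ _ g with () ← g (here refl)
  Increasing-ext {_ ∷ _} {[]} _ _ f _ with () ← f (here refl)
  Increasing-ext {x ∷ xs} {y ∷ ys} ix@(x< ∷ ixs) iy@(y< ∷ iys) f g
    with refl ← ≤-antisym (head≤ ix (g (here refl))) (head≤ iy (f (here refl))) =
    cong (x ∷_) (Increasing-ext ixs iys (λ v∈ → strip x< v∈ (f (there v∈))) (λ v∈ → strip y< v∈ (g (there v∈))))
    where
    strip : ∀ {v xs ys} → All (x <_) xs → v ∈ xs → v ∈ x ∷ ys → v ∈ ys
    strip x< v∈ (here refl) = ⊥-elim (<-irrefl refl (All.lookup x< v∈))
    strip x< v∈ (there q)   = q

  fromPositions : List ℕ → Cell (suc M)
  fromPositions l = Vec.tabulate (λ v → ⌊ pos v ∈? l ⌋)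

  positions-fromPositions : ∀ {l} → Increasing l → All (_≤ M) l → positions (fromPositions l) ≡ l
  positions-fromPositions {l} inc l≤ = Increasing-ext (positions-increasing c) inc sub sup
    where
    c = fromPositions l
    lookup-c : ∀ v → lookup c v ≡ ⌊ pos v ∈? l ⌋
    lookup-c = Vec.lookup∘tabulate (λ v → ⌊ pos v ∈? l ⌋)
    sub : ∀ {v} → v ∈ positions c → v ∈ l
    sub p∈ with v , refl , t ← ∈-positions⁻ c p∈ = toWitness {a? = pos v ∈? l} (subst T (lookup-c v) t)
    sup : ∀ {v} → v ∈ l → v ∈ positions c
    sup p∈ with v , refl ← vertex (All.lookup l≤ p∈) =
      ∈-positions⁺ c v (subst T (sym (lookup-c v)) (fromWitness {a? = pos v ∈? l} p∈))

  -- Separation and edges: from vertices to positions and back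

  all-members⁺ : ∀ (c : Cell (suc M)) (P : Fin (suc M) → Bool) → (∀ v → T (v ∈ᶜ c) → T (P v)) →
                 T (all (λ v → not (v ∈ᶜ c) ∨ P v) (allFin (suc M)))
  all-members⁺ c P f = All.all⁻ _ (All.tabulate {xs = allFin (suc M)} λ {v} _ → T-⇒⁺ {v ∈ᶜ c} (f v))

  all-members⁻ : ∀ (c : Cell (suc M)) (P : Fin (suc M) → Bool) →
                 T (all (λ v → not (v ∈ᶜ c) ∨ P v) (allFin (suc M))) →
                 ∀ v → T (v ∈ᶜ c) → T (P v)
  all-members⁻ c P t v = T-⇒⁻ {v ∈ᶜ c} (All.lookup (All.all⁺ (λ v → not (v ∈ᶜ c) ∨ P v) (allFin (suc M)) t) (∈-allFin v))

  VertexSeparated : Fin (suc M) → Fin (suc M) → Cell (suc M) → Cell (suc M) → Set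
  VertexSeparated i j A B = toℕ i ≤ toℕ j × (∀ v → T (v ∈ᶜ A) → toℕ i ≤ toℕ v × toℕ v ≤ toℕ j)
                                          × (∀ v → T (v ∈ᶜ B) → toℕ v ≤ toℕ i ⊎ toℕ j ≤ toℕ v)

  SepBy⁻ : ∀ {i j A B} → T (SepBy i j A B) → VertexSeparated i j A B
  SepBy⁻ {i} {j} {A} {B} t with t₁ , t₂ ← T-∧ {i ≤ᶠ j} .to t
    with t₃ , t₄ ← T-∧ {all (λ x → not (x ∈ᶜ A) ∨ ((i ≤ᶠ x) ∧ (x ≤ᶠ j))) (allFin (suc M))} .to t₂ =
      ≤ᵇ⇒≤ _ _ t₁
    , (λ v v∈ → let p , q = T-∧ {i ≤ᶠ v} .to (all-members⁻ A (λ x → (i ≤ᶠ x) ∧ (x ≤ᶠ j)) t₃ v v∈)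
                in ≤ᵇ⇒≤ _ _ p , ≤ᵇ⇒≤ _ _ q)
    , (λ v v∈ → [ inj₁ ∘ ≤ᵇ⇒≤ _ _ , inj₂ ∘ ≤ᵇ⇒≤ _ _ ]′
                  (T-∨ {v ≤ᶠ i} .to (all-members⁻ B (λ x → (x ≤ᶠ i) ∨ (j ≤ᶠ x)) t₄ v v∈)))

  SepBy⁺ : ∀ {i j A B} → VertexSeparated i j A B → T (SepBy i j A B)
  SepBy⁺ {i} {j} {A} {B} (i≤j , f , g) = T-∧ {i ≤ᶠ j} .from (≤⇒≤ᵇ i≤j , T-∧ .from
    ( all-members⁺ A (λ x → (i ≤ᶠ x) ∧ (x ≤ᶠ j)) (λ v v∈ → let p , q = f v v∈ in T-∧ {i ≤ᶠ v} .from (≤⇒≤ᵇ p , ≤⇒≤ᵇ q))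
    , all-members⁺ B (λ x → (x ≤ᶠ i) ∨ (j ≤ᶠ x)) (λ v v∈ → T-∨ {v ≤ᶠ i} .from ([ inj₁ ∘ ≤⇒≤ᵇ , inj₂ ∘ ≤⇒≤ᵇ ]′ (g v v∈)))))

  -- The rotation carries vertex 0 from the low end to the high end. A chord from 0 to j + 1 becomes
  -- the one from j to M with its two arcs exchanged, hence the `inj₂`; chords avoiding vertex 0 are
  -- only shifted.
  separated-positions : ∀ i j {A B} → VertexSeparated i j A B → NonOverlap (positions A) (positions B)
  separated-positions zero zero {A} {B} (_ , f , g) = inj₁ (M , M , ≤-refl
    , All-positions⁺ A (λ where
        zero v∈    → ≤-refl , ≤-refl
        (suc _) v∈ → ⊥-elim (n≮0 (proj₂ (f _ v∈))))
    , All.map inj₁ (positions-≤M B))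
  separated-positions zero (suc j) {A} {B} (_ , f , g) = inj₂ (toℕ j , M , <⇒≤ (toℕ<n j)
    , All-positions⁺ B (λ where
        zero v∈    → <⇒≤ (toℕ<n j) , ≤-refl
        (suc w) v∈ → [ (λ ()) , (λ j≤w → ≤-pred j≤w , <⇒≤ (toℕ<n w)) ]′ (g (suc w) v∈))
    , All-positions⁺ A (λ where
        zero v∈    → inj₂ ≤-refl
        (suc w) v∈ → inj₁ (≤-pred (proj₂ (f (suc w) v∈)))))
  separated-positions (suc i) (suc j) {A} {B} (s≤s i≤j , f , g) = inj₁ (toℕ i , toℕ j , i≤j
    , All-positions⁺ A (λ where
        zero v∈    → ⊥-elim (n≮0 (proj₁ (f zero v∈)))
        (suc w) v∈ → let p , q = f (suc w) v∈ in ≤-pred p , ≤-pred q)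
    , All-positions⁺ B (λ where
        zero v∈    → inj₂ (<⇒≤ (toℕ<n j))
        (suc w) v∈ → [ inj₁ ∘ ≤-pred , inj₂ ∘ ≤-pred ]′ (g (suc w) v∈)))

  separated-vertices : ∀ {A B} → Separated (positions A) (positions B) →
                       ∃₂ λ i j → VertexSeparated i j A B ⊎ VertexSeparated i j B A
  -- The ends p and q are arbitrary numbers; from M upwards they all act as vertex 0.
  separated-vertices {A} {B} (p , q , p≤q , wA , oB) with q <? M | p <? M
  ... | yes q<M | no p≮M = ⊥-elim (p≮M (≤-<-trans p≤q q<M))
  ... | yes q<M | yes p<M = suc (fromℕ< p<M) , suc (fromℕ< q<M) , inj₁ (low _ _ (toℕ-fromℕ< p<M) (toℕ-fromℕ< q<M))
    where
    low : ∀ (i j : Fin M) → toℕ i ≡ p → toℕ j ≡ q → VertexSeparated (suc i) (suc j) A B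
    low i j refl refl = s≤s p≤q
      , (λ where
          zero v∈    → ⊥-elim (<⇒≱ q<M (proj₂ (All-positions⁻ A wA zero v∈)))
          (suc w) v∈ → let a , b = All-positions⁻ A wA (suc w) v∈ in s≤s a , s≤s b)
      , (λ where
          zero v∈    → inj₁ z≤n
          (suc w) v∈ → [ inj₁ ∘ s≤s , inj₂ ∘ s≤s ]′ (All-positions⁻ B oB (suc w) v∈))
  ... | no q≮M | yes p<M = zero , suc (fromℕ< p<M) , inj₂ (high _ (toℕ-fromℕ< p<M))
    where
    high : ∀ (i : Fin M) → toℕ i ≡ p → VertexSeparated zero (suc i) B A
    high i refl = z≤n
      , (λ where
          zero v∈    → z≤n , z≤n
          (suc w) v∈ → z≤n , [ s≤s , (λ q≤w → ⊥-elim (q≮M (≤-<-trans q≤w (toℕ<n w)))) ]′ (All-positions⁻ B oB (suc w) v∈))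
      , (λ where
          zero v∈    → inj₁ z≤n
          (suc w) v∈ → inj₂ (s≤s (proj₁ (All-positions⁻ A wA (suc w) v∈))))
  ... | no _ | no p≮M = zero , zero , inj₁ (z≤n
      , (λ where
          zero v∈    → z≤n , z≤n
          (suc w) v∈ → ⊥-elim (p≮M (≤-<-trans (proj₁ (All-positions⁻ A wA (suc w) v∈)) (toℕ<n w))))
      , (λ v _ → inj₂ z≤n))

  nonOverlap⁻ : ∀ {A B} → T (nonOverlap A B) → NonOverlap (positions A) (positions B)
  nonOverlap⁻ {A} {B} t
    with i , tᵢ ← ∃-any⁻ (λ i → any (λ j → SepBy i j A B ∨ SepBy i j B A) (allFin (suc M))) t
    with j , tⱼ ← ∃-any⁻ (λ j → SepBy i j A B ∨ SepBy i j B A) tᵢ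
    with T-∨ {SepBy i j A B} .to tⱼ
  ... | inj₁ s = separated-positions i j {A} {B} (SepBy⁻ {A = A} {B} s)
  ... | inj₂ s = swap (separated-positions i j {B} {A} (SepBy⁻ {A = B} {A} s))

  nonOverlap-vertices : ∀ {A B} → NonOverlap (positions A) (positions B) →
                        ∃₂ λ i j → VertexSeparated i j A B ⊎ VertexSeparated i j B A
  nonOverlap-vertices {A} {B} (inj₁ s) = separated-vertices {A} {B} s
  nonOverlap-vertices {A} {B} (inj₂ s) with i , j , v ← separated-vertices {B} {A} s = i , j , swap v

  nonOverlap⁺ : ∀ {A B} → NonOverlap (positions A) (positions B) → T (nonOverlap A B)
  nonOverlap⁺ {A} {B} o with i , j , s ← nonOverlap-vertices {A} {B} o =
    ∃-any⁺ (λ i → any (λ j → SepBy i j A B ∨ SepBy i j B A) (allFin (suc M))) i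
      (∃-any⁺ (λ j → SepBy i j A B ∨ SepBy i j B A) j
        (T-∨ {SepBy i j A B} .from ([ inj₁ ∘ SepBy⁺ {A = A} {B} , inj₂ ∘ SepBy⁺ {A = B} {A} ]′ s)))

  isEdge⁺ : ∀ {c a b} → toℕ a < toℕ b → T (a ∈ᶜ c) → T (b ∈ᶜ c) →
            (∀ v → T (v ∈ᶜ c) → ¬ (toℕ a < toℕ v × toℕ v < toℕ b)) ⊎
            (∀ v → T (v ∈ᶜ c) → toℕ a ≤ toℕ v × toℕ v ≤ toℕ b) →
            T (isEdge c a b)
  isEdge⁺ {c} {a} {b} a<b a∈ b∈ arc =
    T-∧ {a <ᶠ b} .from (<⇒<ᵇ a<b , T-∧ {a ∈ᶜ c} .from (a∈ , T-∧ {b ∈ᶜ c} .from (b∈ , T-∨ .from (arcs arc))))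
    where
    arcs : _ → _ ⊎ _
    arcs (inj₁ f) = inj₁ (all-members⁺ c (λ x → not ((a <ᶠ x) ∧ (x <ᶠ b))) λ v v∈ → T-not⁺ λ t →
      let p , q = T-∧ {a <ᶠ v} .to t in f v v∈ (<ᵇ⇒< _ _ p , <ᵇ⇒< _ _ q))
    arcs (inj₂ f) = inj₂ (all-members⁺ c (λ x → (a ≤ᶠ x) ∧ (x ≤ᶠ b)) λ v v∈ →
      let p , q = f v v∈ in T-∧ {a ≤ᶠ v} .from (≤⇒≤ᵇ p , ≤⇒≤ᵇ q))

  isEdge⁻ : ∀ {c : Cell (suc M)} {a b} → T (isEdge c a b) → toℕ a < toℕ b × T (a ∈ᶜ c) × T (b ∈ᶜ c)
  isEdge⁻ {c} {a} {b} t with p , t′ ← T-∧ {a <ᶠ b} .to t with a∈ , t″ ← T-∧ {a ∈ᶜ c} .to t′ =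
    <ᵇ⇒< _ _ p , a∈ , proj₁ (T-∧ {b ∈ᶜ c} .to t″)

  isEdge-inner : ∀ {c} (i j : Fin M) → Edge (positions c) (toℕ i) (toℕ j) → T (isEdge c (suc i) (suc j))
  isEdge-inner {c} i j (i<j , i∈ , j∈ , arc) =
    isEdge⁺ {c} {suc i} {suc j} (s≤s i<j) (∈ᶜ-of-position c i∈) (∈ᶜ-of-position c j∈) (arcs arc)
    where
    arcs : _ → _ ⊎ _
    arcs (inj₁ out) = inj₁ λ where
      zero    v∈ (() , _)
      (suc w) v∈ (s≤s i<w , s≤s w<j) → [ <⇒≱ i<w , <⇒≱ w<j ]′ (All-positions⁻ c out (suc w) v∈)
    arcs (inj₂ wit) = inj₂ λ where
      zero    v∈ → ⊥-elim (<⇒≱ (toℕ<n j) (proj₂ (All-positions⁻ c wit zero v∈)))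
      (suc w) v∈ → let p , q = All-positions⁻ c wit (suc w) v∈ in s≤s p , s≤s q

  -- Position M is vertex 0, now the smaller end of the pair, so the inner and the outer arc change
  -- places.
  isEdge-outer : ∀ {c} (i : Fin M) → Edge (positions c) (toℕ i) M → T (isEdge c zero (suc i))
  isEdge-outer {c} i (i<M , i∈ , M∈ , arc) =
    isEdge⁺ {c} {zero} {suc i} (s≤s z≤n) (∈ᶜ-of-position c {zero} M∈) (∈ᶜ-of-position c {suc i} i∈) (arcs arc)
    where
    arcs : _ → _ ⊎ _
    arcs (inj₂ wit) = inj₁ λ where
      zero    v∈ (() , _)
      (suc w) v∈ (_ , s≤s w<i) → <⇒≱ w<i (proj₁ (All-positions⁻ c wit (suc w) v∈))
    arcs (inj₁ out) = inj₂ λ where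
      zero    v∈ → z≤n , z≤n
      (suc w) v∈ → z≤n , [ s≤s , (λ M≤w → ⊥-elim (<⇒≱ (toℕ<n w) M≤w)) ]′ (All-positions⁻ c out (suc w) v∈)

  shareEdge⁺ : ∀ {A B u v} → Edge (positions A) u v → Edge (positions B) u v → T (shareEdge A B)
  shareEdge⁺ {A} {B} {u} {v} eA@(u<v , _ , v∈ , _) eB with v≤M ← All.lookup (positions-≤M A) v∈
    with u<M ← <-≤-trans u<v v≤M = go (fromℕ< u<M) (toℕ-fromℕ< u<M) (m≤n⇒m<n∨m≡n v≤M)
    where
    wrap : ∀ a b → T (isEdge A a b) → T (isEdge B a b) → T (shareEdge A B)
    wrap a b tA tB = ∃-any⁺ (λ a → any (λ b → isEdge A a b ∧ isEdge B b a ∨ isEdge A a b ∧ isEdge B a b) (allFin (suc M))) a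
      (∃-any⁺ (λ b → isEdge A a b ∧ isEdge B b a ∨ isEdge A a b ∧ isEdge B a b) b
        (T-∨ {isEdge A a b ∧ isEdge B b a} .from (inj₂ (T-∧ {isEdge A a b} .from (tA , tB)))))
    go : (i : Fin M) → toℕ i ≡ u → v < M ⊎ v ≡ M → T (shareEdge A B)
    go i refl (inj₂ refl) = wrap zero (suc i) (isEdge-outer {A} i eA) (isEdge-outer {B} i eB)
    go i refl (inj₁ v<M)  = inner (fromℕ< v<M) (toℕ-fromℕ< v<M)
      where
      inner : (j : Fin M) → toℕ j ≡ v → T (shareEdge A B)
      inner j refl = wrap (suc i) (suc j) (isEdge-inner {A} i j eA) (isEdge-inner {B} i j eB)

  shareEdge-endpoints : ∀ {A B : Cell (suc M)} {a b} → T (isEdge A a b ∧ isEdge B b a) ⊎ T (isEdge A a b ∧ isEdge B a b) →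
           a ≢ b × (T (a ∈ᶜ A) × T (b ∈ᶜ A)) × (T (a ∈ᶜ B) × T (b ∈ᶜ B))
  shareEdge-endpoints {A} {B} {a} {b} (inj₁ t) with eA , eB ← T-∧ {isEdge A a b} .to t
    with a<b , a∈ , b∈ ← isEdge⁻ {A} {a} {b} eA | b<a , _ ← isEdge⁻ {B} {b} {a} eB = ⊥-elim (<-asym a<b b<a)
  shareEdge-endpoints {A} {B} {a} {b} (inj₂ t) with eA , eB ← T-∧ {isEdge A a b} .to t
    with a<b , a∈ , b∈ ← isEdge⁻ {A} {a} {b} eA | _ , a∈′ , b∈′ ← isEdge⁻ {B} {a} {b} eB =
    (λ where refl → <-irrefl refl a<b) , (a∈ , b∈) , (a∈′ , b∈′)

  shareEdge⁻ : ∀ {A B} → T (shareEdge A B) → ∃₂ (CommonChord (positions A) (positions B))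
  shareEdge⁻ {A} {B} t
    with a , tₐ ← ∃-any⁻ (λ a → any (λ b → isEdge A a b ∧ isEdge B b a ∨ isEdge A a b ∧ isEdge B a b) (allFin (suc M))) t
    with b , t′ ← ∃-any⁻ (λ b → isEdge A a b ∧ isEdge B b a ∨ isEdge A a b ∧ isEdge B a b) tₐ
    with a≢b , (a∈A , b∈A) , (a∈B , b∈B) ← shareEdge-endpoints {A} {B} (T-∨ {isEdge A a b ∧ isEdge B b a} .to t′)
    with <-cmp (pos a) (pos b)
  ... | tri< lt _ _ = pos a , pos b , lt
    , (∈-positions⁺ A a a∈A , ∈-positions⁺ A b b∈A) , (∈-positions⁺ B a a∈B , ∈-positions⁺ B b b∈B)
  ... | tri≈ _ eq _ = ⊥-elim (a≢b (pos-injective eq))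
  ... | tri> _ _ gt = pos b , pos a , gt
    , (∈-positions⁺ A b b∈A , ∈-positions⁺ A a a∈A) , (∈-positions⁺ B b b∈B , ∈-positions⁺ B a a∈B)

  containsMarked⁺ : ∀ {c} → 0 < M → 0 ∈ positions c → M ∈ positions c → T (containsMarked c)
  containsMarked⁺ {c} 0<M 0∈ M∈ = go (fromℕ< 0<M) (toℕ-fromℕ< 0<M)
    where
    go : (i : Fin M) → toℕ i ≡ 0 → T (containsMarked c)
    go i i≡0 = ∃-any⁺ (λ a → any (λ b → (toℕ a ≡ᵇ 0) ∧ (toℕ b ≡ᵇ 1) ∧ isEdge c a b) (allFin (suc M))) zero
      (∃-any⁺ (λ b → (toℕ b ≡ᵇ 1) ∧ isEdge c zero b) (suc i)
        (T-∧ {toℕ i ≡ᵇ 0} .from (≡⇒≡ᵇ _ _ i≡0 , isEdge-outer {c} i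
          (subst (_< M) (sym i≡0) 0<M , subst (_∈ positions c) (sym i≡0) 0∈ , M∈
          , inj₂ (All.map (λ v≤M → subst (_≤ _) (sym i≡0) z≤n , v≤M) (positions-≤M c))))))

  containsMarked⁻ : ∀ {c} → T (containsMarked c) → 0 ∈ positions c × M ∈ positions c
  containsMarked⁻ {c} t
    with a , tₐ ← ∃-any⁻ (λ a → any (λ b → (toℕ a ≡ᵇ 0) ∧ (toℕ b ≡ᵇ 1) ∧ isEdge c a b) (allFin (suc M))) t
    with b , t′ ← ∃-any⁻ (λ b → (toℕ a ≡ᵇ 0) ∧ (toℕ b ≡ᵇ 1) ∧ isEdge c a b) tₐ
    with a≡0 , t″ ← T-∧ {toℕ a ≡ᵇ 0} .to t′
    with b≡1 , e ← T-∧ {toℕ b ≡ᵇ 1} .to t″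
    with _ , a∈ , b∈ ← isEdge⁻ {c} {a} {b} e = go a b (≡ᵇ⇒≡ _ _ a≡0) (≡ᵇ⇒≡ _ _ b≡1) a∈ b∈
    where
    go : ∀ a b → toℕ a ≡ 0 → toℕ b ≡ 1 → T (a ∈ᶜ c) → T (b ∈ᶜ c) → 0 ∈ positions c × M ∈ positions c
    go zero (suc b) refl e a∈ b∈ = subst (_∈ positions c) (suc-injective e) (∈-positions⁺ c (suc b) b∈) , ∈-positions⁺ c zero a∈

-- Coloured dissections as candidates

status : Bool → Status
status true  = black
status false = white

status-isBlack : ∀ s → s ≢ absent → status (isBlack s) ≡ s
status-isBlack absent h = ⊥-elim (h refl)
status-isBlack black  _ = refl
status-isBlack white  _ = refl

isBlack-status : ∀ b → isBlack (status b) ≡ b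
isBlack-status true  = refl
isBlack-status false = refl

status≢absent : ∀ b → status b ≢ absent
status≢absent true  ()
status≢absent false ()

absent? : ∀ s → Dec (s ≡ absent)
absent? absent = yes refl
absent? black  = no λ ()
absent? white  = no λ ()

sameColour⁺ : ∀ {s t} → s ≢ absent → isBlack s ≡ isBlack t → t ≢ absent → T (sameColour s t)
sameColour⁺ {absent} h _ _ = h refl
sameColour⁺ {black} {black} _ _ _ = _
sameColour⁺ {white} {white} _ _ _ = _
sameColour⁺ {white} {absent} _ _ h = h refl

sameColour⁻ : ∀ {s t} → T (sameColour s t) → isBlack s ≡ isBlack t
sameColour⁻ {black} {black} _ = refl
sameColour⁻ {white} {white} _ = refl

statusIn : List ColouredCell → List ℕ → Status
statusIn []            l = absent
statusIn ((c , s) ∷ L) l with ≡-dec _≟_ c l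
... | yes _ = status s
... | no  _ = statusIn L l

statusIn⁻ : ∀ L l → statusIn L l ≢ absent → (l , isBlack (statusIn L l)) ∈ L
statusIn⁻ [] l h = ⊥-elim (h refl)
statusIn⁻ ((c , s) ∷ L) l h with ≡-dec _≟_ c l
... | yes refl = here (cong (c ,_) (isBlack-status s))
... | no  _    = there (statusIn⁻ L l h)

statusIn⁺ : ∀ {L l s} → AllPairs (_≢_ on proj₁) L → (l , s) ∈ L → statusIn L l ≡ status s
statusIn⁺ {(c , t) ∷ L} {l} (h ∷ hs) l∈ with ≡-dec _≟_ c l | l∈
... | yes refl | here refl = refl
... | yes refl | there q   = ⊥-elim (All.lookup h q refl)
... | no c≢l   | here refl = ⊥-elim (c≢l refl)
... | no _     | there q   = statusIn⁺ hs q

#black+#white : {A : Set} (L : List (A × Bool)) → #black L + #white L ≡ length L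
#black+#white [] = refl
#black+#white ((_ , true) ∷ L)  = cong suc (#black+#white L)
#black+#white ((_ , false) ∷ L) = trans (+-suc _ _) (cong suc (#black+#white L))

overlapFree : ∀ {N} → Cell N × Status → Cell N × Status → Bool
overlapFree p q = nonOverlap (proj₁ p) (proj₁ q)

markedBlack : ∀ {N} → Cell N × Status → Bool
markedBlack p = not (containsMarked (proj₁ p)) ∨ isBlack (proj₂ p)

alternating : ∀ {N} → Cell N × Status → Cell N × Status → Bool
alternating p q = not (shareEdge (proj₁ p) (proj₁ q)) ∨ not (sameColour (proj₂ p) (proj₂ q))

-- The test of `isColouredDissection` with the list of used cells abstracted. It unfolds to the same
-- term, so the number of vertices can be rewritten later from (d - 1) n + 2 to 2 + (d - 1) n.
isColouring : ∀ {N} → ℕ → List (Cell N × Status) → Bool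
isColouring n L = (length L ≡ᵇ n) ∧ allPairs overlapFree L ∧ all markedBlack L ∧ allPairs alternating L

record Colouring {N : ℕ} (n : ℕ) (L : List (Cell N × Status)) : Set where
  field
    size         : length L ≡ n
    overlapFrees : AllPairs (λ p q → T (overlapFree p q)) L
    markedBlacks : All (T ∘ markedBlack) L
    alternatings : AllPairs (λ p q → T (alternating p q)) L

isColouring⁺ : ∀ {N n} {L : List (Cell N × Status)} → Colouring n L → T (isColouring n L)
isColouring⁺ {n = n} {L} c = T-∧ {length L ≡ᵇ n} .from (≡⇒≡ᵇ _ _ size , T-∧ {allPairs overlapFree L} .from
  (allPairs⁺ overlapFree overlapFrees , T-∧ {all markedBlack L} .from
  (All.all⁻ markedBlack markedBlacks , allPairs⁺ alternating alternatings)))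
  where open Colouring c

isColouring⁻ : ∀ {N} n (L : List (Cell N × Status)) → T (isColouring n L) → Colouring n L
isColouring⁻ n L t
  with t₁ , t′ ← T-∧ {length L ≡ᵇ n} .to t
  with t₂ , t″ ← T-∧ {allPairs overlapFree L} .to t′
  with t₃ , t₄ ← T-∧ {all markedBlack L} .to t″ = record
  { size = ≡ᵇ⇒≡ _ _ t₁ ; overlapFrees = allPairs⁻ overlapFree L t₂
  ; markedBlacks = All.all⁺ markedBlack L t₃ ; alternatings = allPairs⁻ alternating L t₄ }

module Dissections (m n M : ℕ) (M≡ : M ≡ 1 + suc m * n) where

  open Count m
  open Codes m
  open Completeness m

  N : ℕ
  N = suc M

  open Positions {M}

  allCells : List (Cell N)
  allCells = cells d N

  candidateUsed : Candidate d N → List (Cell N × Status)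
  candidateUsed = used {d} {N}

  ∈-used⁻ : ∀ v {p} → p ∈ candidateUsed v → p ∈ zip allCells (Vec.toList v) × proj₂ p ≢ absent
  ∈-used⁻ v p∈ = ∈-filter⁻ _ p∈

  ∈-used⁺ : ∀ v {p} → p ∈ zip allCells (Vec.toList v) → proj₂ p ≢ absent → p ∈ candidateUsed v
  ∈-used⁺ v p∈ h = ∈-filter⁺ _ p∈ h

  used-distinct : ∀ v → AllPairs (_≢_ on proj₁) (candidateUsed v)
  used-distinct v = AllPairs.filter⁺ _ (zip-distinct (Vec.toList v) (cells-unique d N))

  used-present : ∀ v → All (λ p → proj₂ p ≢ absent) (candidateUsed v)
  used-present v = All.tabulate (λ p∈ → proj₂ (∈-used⁻ v p∈))

  coloured : Cell N × Status → ColouredCell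
  coloured (c , s) = positions c , isBlack s

  cellsOf : Candidate d N → List ColouredCell
  cellsOf v = map coloured (candidateUsed v)

  cellsOf-unique : ∀ v → Unique (cellsOf v)
  cellsOf-unique v = AllPairs.map⁺ (AllPairs.map (λ c≢ e → c≢ (positions-injective (cong proj₁ e))) (used-distinct v))

  #black-coloured : ∀ L → #black (map coloured L) ≡ length (filter (λ p → T? (isBlack (proj₂ p))) L)
  #black-coloured [] = refl
  #black-coloured ((_ , absent) ∷ L) = #black-coloured L
  #black-coloured ((_ , black) ∷ L)  = cong suc (#black-coloured L)
  #black-coloured ((_ , white) ∷ L)  = #black-coloured L

  #white-coloured : ∀ {L} → All (λ p → proj₂ p ≢ absent) L →
                    #white (map coloured L) ≡ length (filter (λ p → T? (isWhite (proj₂ p))) L)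
  #white-coloured [] = refl
  #white-coloured {(_ , absent) ∷ L} (h ∷ _)  = ⊥-elim (h refl)
  #white-coloured {(_ , black) ∷ L}  (_ ∷ hs) = #white-coloured hs
  #white-coloured {(_ , white) ∷ L}  (_ ∷ hs) = cong suc (#white-coloured hs)

  excess-cellsOf : ∀ v → excess {d} {N} v ≡ ℤ.+ #black (cellsOf v) ℤ.- ℤ.+ #white (cellsOf v)
  excess-cellsOf v =
    sym (cong₂ (λ a b → ℤ.+ a ℤ.- ℤ.+ b) (#black-coloured (candidateUsed v)) (#white-coloured (used-present v)))

  candidate : List ColouredCell → Candidate d N
  candidate L = Vec.map (statusIn L ∘ positions) (Vec.fromList allCells)

  zip-candidate : ∀ L → zip allCells (Vec.toList (candidate L)) ≡ map (λ c → c , statusIn L (positions c)) allCells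
  zip-candidate L = trans
    (cong (zip allCells) (trans (Vec.toList-map (statusIn L ∘ positions) (Vec.fromList allCells))
                                (cong (map (statusIn L ∘ positions)) (Vec.toList∘fromList allCells))))
    (zip-map (statusIn L ∘ positions) allCells)

  Valid : List ColouredCell → Set
  Valid L = All (λ c → IsCell (proj₁ c) × All (_≤ M) (proj₁ c)) L × AllPairs (_≢_ on proj₁) L

  cellsOf-candidate : ∀ {L} → Valid L → cellsOf (candidate L) ↭ L
  cellsOf-candidate {L} (cell , distinct) =
    same-members⇒↭ (cellsOf-unique (candidate L)) (AllPairs.map (λ c≢ → c≢ ∘ cong proj₁) distinct) sub sup
    where
    sub : ∀ {c} → c ∈ cellsOf (candidate L) → c ∈ L
    sub c∈ with p , p∈ , refl ← ∈-map⁻ coloured c∈ with z , h ← ∈-used⁻ (candidate L) p∈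
      with c , _ , refl ← ∈-map⁻ (λ c → c , statusIn L (positions c)) (subst (p ∈_) (zip-candidate L) z) =
      statusIn⁻ L (positions c) h
    sup : ∀ {c} → c ∈ L → c ∈ cellsOf (candidate L)
    sup {l , s} c∈ with (inc , len) , l≤ ← All.lookup cell c∈ =
      subst (_∈ cellsOf (candidate L)) (cong₂ _,_ posC (trans (cong isBlack st) (isBlack-status s)))
        (∈-map⁺ coloured (∈-used⁺ (candidate L)
          (subst ((c , statusIn L (positions c)) ∈_) (sym (zip-candidate L)) (∈-map⁺ (λ c → c , statusIn L (positions c)) c∈C))
          (λ e → status≢absent s (trans (sym st) e))))
      where
      c = fromPositions l
      posC : positions c ≡ l
      posC = positions-fromPositions inc l≤
      st : statusIn L (positions c) ≡ status s
      st = trans (cong (statusIn L) posC) (statusIn⁺ distinct c∈)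
      c∈C : c ∈ allCells
      c∈C = ∈-cells⁺ c (trans (sym (length-positions c)) (trans (cong length posC) len))

  -- A cell used in `v` has its status in L by distinctness; a cell absent from `v` cannot occur in
  -- L, as it would then be listed in `v` with a second status.
  candidate-unique : ∀ v {L} → L ↭ cellsOf v → AllPairs (_≢_ on proj₁) L → v ≡ candidate L
  candidate-unique v {L} perm distinct = map-fromList v (statusIn L ∘ positions) agree
    where
    agree : ∀ {c s} → (c , s) ∈ zip allCells (Vec.toList v) → s ≡ statusIn L (positions c)
    agree {c} {s} z∈ with absent? s
    ... | no s≢ = sym (trans
            (statusIn⁺ distinct (∈-resp-↭ (↭-sym perm) (∈-map⁺ coloured (∈-used⁺ v z∈ s≢)))) (status-isBlack s s≢))
    ... | yes refl with absent? (statusIn L (positions c))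
    ...   | yes e = sym e
    ...   | no h with p , p∈ , e ← ∈-map⁻ coloured (∈-resp-↭ perm (statusIn⁻ L (positions c) h))
            with q , p≢ ← ∈-used⁻ v p∈
            with AllPairs-lookup (_∘ sym) (zip-distinct (Vec.toList v) (cells-unique d N)) z∈ q
    ...     | inj₁ refl = ⊥-elim (p≢ refl)
    ...     | inj₂ c≢   = ⊥-elim (c≢ (positions-injective (cong proj₁ e)))

  -- The bijection between trees and coloured dissections

  Tree : Set
  Tree = Code (true ∷ [])

  ends-tree : ∀ (k : Tree) → length (nodes k 0) ≡ n → ends k 0 ≡ M ∷ []
  ends-tree k len = single (ends k 0) (length-ends k 0) (trans (last-ends k 0) (trans (cong (λ l → 1 + D * l) len) (sym M≡)))
    where
    single : ∀ l → length l ≡ 1 → last 0 l ≡ M → l ≡ M ∷ []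
    single (_ ∷ []) _ refl = refl

  tree-slots : ∀ (k : Tree) → length (nodes k 0) ≡ n → All (InSlot 0 (M ∷ []) (true ∷ [])) (nodes k 0)
  tree-slots k len = subst (λ e → All (InSlot 0 e (true ∷ [])) (nodes k 0)) (ends-tree k len) (nodes-InSlot k 0)

  tree-within : ∀ (k : Tree) → length (nodes k 0) ≡ n →
                All (λ c → Within 0 M (proj₁ c) × (0 ∈ proj₁ c → M ∈ proj₁ c → proj₂ c ≡ true)) (nodes k 0)
  tree-within k len = All.map (λ where (here w f) → w , f) (tree-slots k len)

  nodes-distinct : ∀ {cs} (k : Code cs) x → AllPairs (_≢_ on proj₁) (nodes k x)
  nodes-distinct k x = go (nodes-IsCell k x) (nodes-compatible k x)
    where
    go : ∀ {L} → All (IsCell ∘ proj₁) L → AllPairs StronglyCompatible L → AllPairs (_≢_ on proj₁) L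
    go [] [] = []
    go (c ∷ cs) (p ∷ ps) = All.map (compatible⇒distinct c) p ∷ go cs ps

  nodes-valid : ∀ (k : Tree) → length (nodes k 0) ≡ n → Valid (nodes k 0)
  nodes-valid k len =
    All.zipWith (λ (c , w , _) → c , All.map proj₂ w) (nodes-IsCell k 0 , tree-within k len) , nodes-distinct k 0

  decode : Tree → Candidate d N
  decode k = candidate (nodes k 0)

  cellsOf-decode : ∀ k → length (nodes k 0) ≡ n → cellsOf (decode k) ↭ nodes k 0
  cellsOf-decode k len = cellsOf-candidate (nodes-valid k len)

  decode-injective : ∀ k k′ → length (nodes k 0) ≡ n → length (nodes k′ 0) ≡ n → decode k ≡ decode k′ → k ≡ k′
  decode-injective k k′ len len′ e =
    nodes-injective k k′ 0 (trans (ends-tree k len) (sym (ends-tree k′ len′))) (∈-resp-↭ p) (∈-resp-↭ (↭-sym p))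
    where
    p : nodes k 0 ↭ nodes k′ 0
    p = ↭-trans (↭-sym (cellsOf-decode k len)) (↭-trans (↭-reflexive (cong cellsOf e)) (cellsOf-decode k′ len′))

  StronglyCompatible-sym : ∀ {c c′} → StronglyCompatible c c′ → StronglyCompatible c′ c
  StronglyCompatible-sym (o , f) = swap o , λ u v (lt , a , b) → f u v (lt , b , a) ∘ sym

  decode-coloured : ∀ k → length (nodes k 0) ≡ n → T (isColouring n (candidateUsed (decode k)))
  decode-coloured k len = isColouring⁺ record
    { size = trans (sym (length-map coloured L)) (trans (sym (↭-length perm)) len)
    ; overlapFrees = AllPairs.map (λ {p} {q} (o , _) → nonOverlap⁺ {proj₁ p} {proj₁ q} o) pairs
    ; markedBlacks = All.map (λ {p} f → T-⇒⁺ {containsMarked (proj₁ p)} (λ t →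
        let a , b = containsMarked⁻ {proj₁ p} t in T-≡ .from (f a b))) marked
    ; alternatings = AllPairs.map (λ {p} {q} (_ , f) → T-⇒⁺ {shareEdge (proj₁ p) (proj₁ q)} (λ t →
        let u , v , ch = shareEdge⁻ {proj₁ p} {proj₁ q} t in T-not⁺ (f u v ch ∘ sameColour⁻ {proj₂ p} {proj₂ q}))) pairs }
    where
    L = candidateUsed (decode k)
    perm = ↭-sym (cellsOf-decode k len)
    pairs : AllPairs (StronglyCompatible on coloured) L
    pairs = AllPairs.map⁻ (AllPairs-resp-↭ StronglyCompatible-sym perm (nodes-compatible k 0))
    marked : All (λ p → 0 ∈ positions (proj₁ p) → M ∈ positions (proj₁ p) → isBlack (proj₂ p) ≡ true) L
    marked = All.map⁻ (All-resp-↭ perm (All.map proj₂ (tree-within k len)))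

  -- Since M = 1 + D n, the n cells attain the bound of `Filling` on the interval from 0 to M. The
  -- marked edge fixes the root colour as black, and `code-of` supplies the tree.
  coloured⇒decode : ∀ v → T (isColouring n (candidateUsed v)) → ∃ λ k → length (nodes k 0) ≡ n × v ≡ decode k
  coloured⇒decode v t = k , trans (↭-length perm) length≡ , candidate-unique v perm (nodes-distinct k 0)
    where
    L = candidateUsed v
    open Colouring (isColouring⁻ n L t)
    length≡ : length (cellsOf v) ≡ n
    length≡ = trans (length-map coloured L) size
    compatible : ∀ {L} → All (λ p → proj₂ p ≢ absent) L → AllPairs (λ p q → T (overlapFree p q)) L →
                 AllPairs (λ p q → T (alternating p q)) L → AllPairs (Compatible on coloured) L
    compatible [] [] [] = []
    compatible {p ∷ L} (h ∷ hs) (a ∷ as) (b ∷ bs) = All.tabulate (λ {q} q∈ →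
        nonOverlap⁻ {proj₁ p} {proj₁ q} (All.lookup a q∈)
      , λ u v e e′ eq → T-not⁻
          (T-⇒⁻ {shareEdge (proj₁ p) (proj₁ q)} (All.lookup b q∈) (shareEdge⁺ {proj₁ p} {proj₁ q} e e′))
          (sameColour⁺ h eq (All.lookup hs q∈))) ∷ compatible hs as bs
    partial : Partial 0 M (cellsOf v)
    partial = record
      { isCell = All.map⁺ (All.tabulate λ {p} p∈ → positions-increasing (proj₁ p) ,
          trans (length-positions (proj₁ p)) (∈-cells⁻ {d} (zip-⊆ (proj₁ (∈-used⁻ v p∈)))))
      ; within = All.map⁺ (All.tabulate λ {p} _ → All.map (z≤n ,_) (positions-≤M (proj₁ p)))
      ; compatible = AllPairs.map⁺ (compatible (used-present v) overlapFrees alternatings) }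
    root : RootColour 0 M true (cellsOf v)
    root = All.map⁺ (All.map (λ {p} f _ 0∈ M∈ → T-≡ .to (T-⇒⁻ {containsMarked (proj₁ p)} f
        (containsMarked⁺ {proj₁ p} (subst (0 <_) (sym M≡) (s≤s z≤n)) 0∈ M∈)))
      markedBlacks)
    built = code-of M (cellsOf v) partial (trans M≡ (cong (λ l → 1 + D * l) (sym length≡))) root
    k = proj₁ built
    perm : nodes k 0 ↭ cellsOf v
    perm = proj₂ built

  dissections : ℤ → List (Candidate d N)
  dissections e = filter (λ v → excess {d} {N} v ℤ.≟ e)
    (filter (λ v → T? (isColouring n (candidateUsed v))) (vecs statuses (length allCells)))

  dissections-unique : ∀ e → Unique (dissections e)
  dissections-unique e = Unique.filter⁺ _
    (Unique.filter⁺ (λ v → T? (isColouring n (candidateUsed v))) (vecs-unique statuses-unique (length allCells)))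

  excess-decode : ∀ k → length (nodes k 0) ≡ n →
                  excess {d} {N} (decode k) ≡ ℤ.+ #black (nodes k 0) ℤ.- ℤ.+ #white (nodes k 0)
  excess-decode k len = trans (excess-cellsOf (decode k))
    (cong₂ (λ a b → ℤ.+ a ℤ.- ℤ.+ b) (↭-length (filter-↭ (λ p → T? (proj₂ p)) (cellsOf-decode k len)))
                                     (↭-length (filter-↭ (λ p → T? (not (proj₂ p))) (cellsOf-decode k len))))

  ∈-dissections⁻ : ∀ {e v} → v ∈ dissections e → ∃ λ k → length (nodes k 0) ≡ n × v ≡ decode k ×
                   ℤ.+ #black (nodes k 0) ℤ.- ℤ.+ #white (nodes k 0) ≡ e
  ∈-dissections⁻ {e} {v} v∈ = decoded (coloured⇒decode v
      (proj₂ (∈-filter⁻ (λ v → T? (isColouring n (candidateUsed v))) {xs = vecs statuses (length allCells)} (proj₁ split))))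
    where
    split = ∈-filter⁻ (λ v → excess {d} {N} v ℤ.≟ e) v∈
    decoded : (∃ λ k → length (nodes k 0) ≡ n × v ≡ decode k) → _
    decoded (k , len , v≡) = k , len , v≡ , trans (sym (excess-decode k len)) (trans (cong excess′ (sym v≡)) (proj₂ split))
      where
      excess′ : Candidate d N → ℤ
      excess′ = excess {d} {N}

  ∈-dissections⁺ : ∀ {e} k → length (nodes k 0) ≡ n → ℤ.+ #black (nodes k 0) ℤ.- ℤ.+ #white (nodes k 0) ≡ e →
                   decode k ∈ dissections e
  ∈-dissections⁺ {e} k len ex = ∈-filter⁺ (λ v → excess {d} {N} v ℤ.≟ e)
    (∈-filter⁺ (λ v → T? (isColouring n (candidateUsed v))) (∈-vecs ∈-statuses (decode k)) (decode-coloured k len))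
    (trans (excess-decode k len) ex)

  length-dissections : ∀ {a b} → a + b ≡ n → length (dissections (ℤ.+ a ℤ.- ℤ.+ b)) ≡ length (codes (true ∷ []) a b)
  length-dissections {a} {b} a+b≡n = trans
    (↭-length (same-members⇒↭ (dissections-unique (ℤ.+ a ℤ.- ℤ.+ b)) (Unique-map-on inj (codes-unique (true ∷ []) a b))
      (λ v∈ → decoded (∈-dissections⁻ v∈)) (λ v∈ → member (∈-map⁻ decode v∈))))
    (length-map decode (codes (true ∷ []) a b))
    where
    size : ∀ {k} → k ∈ codes (true ∷ []) a b → length (nodes k 0) ≡ n
    size {k} k∈ with p , q ← codes-count a b 0 k∈ = trans (sym (#black+#white (nodes k 0))) (trans (cong₂ _+_ p q) a+b≡n)
    inj : ∀ {k k′} → k ∈ codes (true ∷ []) a b → k′ ∈ codes (true ∷ []) a b → decode k ≡ decode k′ → k ≡ k′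
    inj {k} {k′} k∈ k′∈ = decode-injective k k′ (size k∈) (size k′∈)
    member : ∀ {v} → (∃ λ k → k ∈ codes (true ∷ []) a b × v ≡ decode k) → v ∈ dissections (ℤ.+ a ℤ.- ℤ.+ b)
    member (k , k∈ , v≡) = subst (_∈ dissections (ℤ.+ a ℤ.- ℤ.+ b)) (sym v≡)
      (∈-dissections⁺ k (size k∈) (cong₂ (λ a b → ℤ.+ a ℤ.- ℤ.+ b)
        (proj₁ (codes-count a b 0 k∈)) (proj₂ (codes-count a b 0 k∈))))
    decoded : ∀ {v} → (∃ λ k → length (nodes k 0) ≡ n × v ≡ decode k ×
                ℤ.+ #black (nodes k 0) ℤ.- ℤ.+ #white (nodes k 0) ≡ ℤ.+ a ℤ.- ℤ.+ b) →
              v ∈ map decode (codes (true ∷ []) a b)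
    decoded (k , len , v≡ , ex) = subst (_∈ map decode (codes (true ∷ []) a b)) (sym v≡)
      (∈-map⁺ decode (subst₂ (λ a b → k ∈ codes (true ∷ []) a b) (proj₁ ab) (proj₂ ab) (∈-codes k 0)))
      where
      ab = sum-difference-injective {#black (nodes k 0)} {#white (nodes k 0)} {a} {b}
             (trans (#black+#white (nodes k 0)) (trans len (sym a+b≡n))) ex

  dissections-empty : ∀ {e} → (∀ a b → a + b ≡ n → ℤ.+ a ℤ.- ℤ.+ b ≢ e) → length (dissections e) ≡ 0
  dissections-empty {e} none = no-members (dissections e) λ v v∈ → contra (∈-dissections⁻ v∈)
    where
    contra : ∀ {v} → ¬ (∃ λ k → length (nodes k 0) ≡ n × v ≡ decode k ×
               ℤ.+ #black (nodes k 0) ℤ.- ℤ.+ #white (nodes k 0) ≡ e)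
    contra (k , len , _ , ex) = none (#black (nodes k 0)) (#white (nodes k 0)) (trans (#black+#white (nodes k 0)) len) ex
    no-members : {A : Set} (xs : List A) → (∀ x → x ∉ xs) → length xs ≡ 0
    no-members []       _ = refl
    no-members (x ∷ xs) h = ⊥-elim (h x (here refl))

-- The coefficients of w

fromℕ : ℕ → ℚ
fromℕ c = ι c ℚ./ 1

fromℕ-suc : ∀ c → fromℕ (suc c) ≡ 1ℚ ℚ.+ fromℕ c
fromℕ-suc c = ℚ.toℚᵘ-injective (begin
  ℚ.toℚᵘ (fromℕ (suc c))            ≈⟨ ℚ.toℚᵘ-fromℚᵘ (mkℚᵘ (ι (suc c)) 0) ⟩
  mkℚᵘ (ι (suc c)) 0                ≈⟨ *≡* (lem (ι c)) ⟩
  ℚᵘ.1ℚᵘ ℚᵘ.+ mkℚᵘ (ι c) 0          ≈⟨ ℚᵘ.+-congʳ ℚᵘ.1ℚᵘ (ℚ.toℚᵘ-fromℚᵘ (mkℚᵘ (ι c) 0)) ⟨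
  ℚᵘ.1ℚᵘ ℚᵘ.+ ℚ.toℚᵘ (fromℕ c)      ≈⟨ ℚ.toℚᵘ-homo-+ 1ℚ (fromℕ c) ⟨
  ℚ.toℚᵘ (1ℚ ℚ.+ fromℕ c)           ∎)
  where
  open ℚᵘ.≃-Reasoning
  lem : ∀ x → (ℤ.1ℤ ℤ.+ x) ℤ.* ℤ.1ℤ ≡ (ℤ.1ℤ ℤ.* ℤ.1ℤ ℤ.+ x ℤ.* ℤ.1ℤ) ℤ.* ℤ.1ℤ
  lem = ℤSolver.solve-∀

-- The rational coefficients on the right-hand sides are in fact natural numbers, namely numbers of
-- trees.
quotient≡fromℕ : ∀ {x} r l → suc r * l ≡ x → ι x ℚ./ suc r ≡ fromℕ l
quotient≡fromℕ r l refl = ℚ.fromℚᵘ-cong {mkℚᵘ (ι (suc r * l)) r} {mkℚᵘ (ι l) 0}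
  (*≡* (trans (sym (ℤ.pos-* (suc r * l) 1)) (trans (cong ι (lem (suc r) l)) (ℤ.pos-* l (suc r)))))
  where
  lem : ∀ r l → r * l * 1 ≡ l * r
  lem = solve-∀

mono-hit : ∀ {c k e} → e ≡ k → mono c k e ≡ c
mono-hit {c} {k} {e} e≡k with e ℤ.≟ k
... | yes _ = refl
... | no h  = ⊥-elim (h e≡k)

mono-miss : ∀ {c k e} → e ≢ k → mono c k e ≡ 0ℚ
mono-miss {c} {k} {e} e≢k with e ℤ.≟ k
... | yes h = ⊥-elim (e≢k h)
... | no _  = refl

count-monos : {A : Set} (exponent : A → ℤ) (vs : List A) (e : ℤ) →
              foldr (λ v acc → mono 1ℚ (exponent v) ⊕ acc) 0L vs e ≡ fromℕ (length (filter (λ v → exponent v ℤ.≟ e) vs))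
count-monos f [] e = refl
count-monos f (v ∷ vs) e = by-case (f v ℤ.≟ e)
  where
  open ≡-Reasoning
  rest = foldr (λ v acc → mono 1ℚ (f v) ⊕ acc) 0L vs e
  by-case : Dec (f v ≡ e) → mono 1ℚ (f v) e ℚ.+ rest ≡ fromℕ (length (filter (λ v → f v ℤ.≟ e) (v ∷ vs)))
  by-case (yes h) = begin
    mono 1ℚ (f v) e ℚ.+ rest                 ≡⟨ cong₂ ℚ._+_ (mono-hit {1ℚ} (sym h)) (count-monos f vs e) ⟩
    1ℚ ℚ.+ fromℕ (length (filter (λ v → f v ℤ.≟ e) vs))  ≡⟨ fromℕ-suc (length (filter (λ v → f v ℤ.≟ e) vs)) ⟨
    fromℕ (suc (length (filter (λ v → f v ℤ.≟ e) vs)))   ≡⟨ cong (fromℕ ∘ length) (filter-accept (λ v → f v ℤ.≟ e) {v} {vs} h) ⟨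
    fromℕ (length (filter (λ v → f v ℤ.≟ e) (v ∷ vs))) ∎
  by-case (no h) = begin
    mono 1ℚ (f v) e ℚ.+ rest                 ≡⟨ cong₂ ℚ._+_ (mono-miss {1ℚ} (h ∘ sym)) (count-monos f vs e) ⟩
    0ℚ ℚ.+ fromℕ (length (filter (λ v → f v ℤ.≟ e) vs))  ≡⟨ ℚ.+-identityˡ _ ⟩
    fromℕ (length (filter (λ v → f v ℤ.≟ e) vs))         ≡⟨ cong (fromℕ ∘ length) (filter-reject (λ v → f v ℤ.≟ e) {v} {vs} h) ⟨
    fromℕ (length (filter (λ v → f v ℤ.≟ e) (v ∷ vs))) ∎

module _ (c : ℕ → ℚ) (g : ℕ → ℤ) where

  private
    sum : List ℕ → Laurent
    sum = foldr (λ k acc → mono (c k) (g k) ⊕ acc) 0L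

  sum-miss : ∀ {ks e} → All (λ k → e ≢ g k) ks → sum ks e ≡ 0ℚ
  sum-miss [] = refl
  sum-miss {k ∷ ks} {e} (h ∷ hs) = trans (cong₂ ℚ._+_ (mono-miss {c k} h) (sum-miss hs)) (ℚ.+-identityˡ 0ℚ)

  sum-hit : (∀ {k k′} → g k ≡ g k′ → k ≡ k′) → ∀ {ks k} → Unique ks → k ∈ ks → sum ks (g k) ≡ c k
  sum-hit inj {k ∷ ks} (k∉ ∷ _) (here refl) =
    trans (cong₂ ℚ._+_ (mono-hit {c k} {g k} refl) (sum-miss (All.map (_∘ inj) k∉))) (ℚ.+-identityʳ (c k))
  sum-hit inj {k′ ∷ ks} {k} (k′∉ ∷ u) (there k∈) =
    trans (cong₂ ℚ._+_ (mono-miss {c k′} (λ e → All.lookup k′∉ k∈ (sym (inj e)))) (sum-hit inj u k∈)) (ℚ.+-identityˡ (c k))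

-- The three formulas

module Formula (m : ℕ) where

  open Count m
  open Codes m using (codes; length-codes)

  trees : ℕ → ℕ → ℕ
  trees a b = length (codes (true ∷ []) a b)

  trees-many-whites : ∀ a b → d * a < b → trees a b ≡ 0
  trees-many-whites zero    (suc b) _ = ForestCount-tree₀ b (length-codes (true ∷ []) 0 (suc b))
  trees-many-whites (suc a) b       h = *-cancelˡ-≡ _ 0 (suc a) (begin
    suc a * trees (suc a) b               ≡⟨ ForestCount-tree a b (length-codes (true ∷ []) (suc a) b) ⟩
    ((d * b) C a) * ((d * suc a) C b)     ≡⟨ cong (((d * b) C a) *_) (k>n⇒nCk≡0 h) ⟩
    ((d * b) C a) * 0                     ≡⟨ *-zeroʳ ((d * b) C a) ⟩
    0                                     ≡⟨ *-zeroʳ (suc a) ⟨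
    suc a * 0                             ∎)
    where open ≡-Reasoning

  trees-few-whites : ∀ a b → suc (d * b) < a → trees a b ≡ 0
  trees-few-whites (suc a) b (s≤s h) = *-cancelˡ-≡ _ 0 (suc a) (begin
    suc a * trees (suc a) b               ≡⟨ ForestCount-tree a b (length-codes (true ∷ []) (suc a) b) ⟩
    ((d * b) C a) * ((d * suc a) C b)     ≡⟨ cong (_* ((d * suc a) C b)) (k>n⇒nCk≡0 h) ⟩
    0                                     ≡⟨ *-zeroʳ (suc a) ⟨
    suc a * 0                             ∎)
    where open ≡-Reasoning

  trees-by-blacks : ∀ a b r → a + r ≡ d * b → suc a * trees (suc a) b ≡ ((d * suc a) C b) * ((d * b) C r)
  trees-by-blacks a b r eq = begin
    suc a * trees (suc a) b               ≡⟨ ForestCount-tree a b (length-codes (true ∷ []) (suc a) b) ⟩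
    ((d * b) C a) * ((d * suc a) C b)     ≡⟨ *-comm ((d * b) C a) _ ⟩
    ((d * suc a) C b) * ((d * b) C a)     ≡⟨ cong (λ z → ((d * suc a) C b) * (z C a)) eq ⟨
    ((d * suc a) C b) * ((a + r) C a)     ≡⟨ cong (((d * suc a) C b) *_) (nC[k]-sym a r) ⟩
    ((d * suc a) C b) * ((a + r) C r)     ≡⟨ cong (λ z → ((d * suc a) C b) * (z C r)) eq ⟩
    ((d * suc a) C b) * ((d * b) C r)     ∎
    where open ≡-Reasoning

  -- The same count with the denominator r + 1 = d b - a in place of the number a + 1 of black
  -- cells.
  trees-by-complement : ∀ a b r → a + suc r ≡ d * b → suc r * trees (suc a) b ≡ ((d * suc a) C b) * ((d * b) C r)
  trees-by-complement a b r eq = *-cancelˡ-≡ _ _ (suc a) (begin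
    suc a * (suc r * trees (suc a) b)     ≡⟨ x∙yz≈y∙xz (suc a) (suc r) (trees (suc a) b) ⟩
    suc r * (suc a * trees (suc a) b)     ≡⟨ cong (suc r *_) (ForestCount-tree a b (length-codes (true ∷ []) (suc a) b)) ⟩
    suc r * (((d * b) C a) * Z)           ≡⟨ *-assoc (suc r) ((d * b) C a) Z ⟨
    suc r * ((d * b) C a) * Z             ≡⟨ cong (λ z → suc r * (z C a) * Z) eq ⟨
    suc r * ((a + suc r) C a) * Z         ≡⟨ cong (_* Z) ([1+r]*nCk≡[1+k]*nCr a r) ⟩
    suc a * ((a + suc r) C r) * Z         ≡⟨ cong (λ z → suc a * (z C r) * Z) eq ⟩
    suc a * ((d * b) C r) * Z             ≡⟨ *-assoc (suc a) ((d * b) C r) Z ⟩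
    suc a * (((d * b) C r) * Z)           ≡⟨ cong (suc a *_) (*-comm ((d * b) C r) Z) ⟩
    suc a * (Z * ((d * b) C r))           ∎)
    where
    open ≡-Reasoning
    Z = (d * suc a) C b
    x∙yz≈y∙xz : ∀ x y z → x * (y * z) ≡ y * (x * z)
    x∙yz≈y∙xz = solve-∀

  dissectionCount : ℕ → ℕ → ℤ → ℕ
  dissectionCount N n e = length (filter (λ v → excess {d} {N} v ℤ.≟ e)
    (filter (λ v → T? (isColouring n (used {d} {N} v))) (vecs statuses (length (cells d N)))))

  w≡dissectionCount : ∀ n e → w d n e ≡ fromℕ (dissectionCount (2 + D * n) n e)
  w≡dissectionCount n e = trans (count-monos (excess {d} {nVert d n}) coloured e) (cong fromℕ (trans same shape))
    where
    coloured : List (Candidate d (nVert d n))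
    coloured = filter (λ v → T? (isColouredDissection d n v)) (vecs statuses (length (cells d (nVert d n))))
    same : length (filter (λ v → excess {d} {nVert d n} v ℤ.≟ e) coloured) ≡ dissectionCount (nVert d n) n e
    same = refl
    shape : dissectionCount (nVert d n) n e ≡ dissectionCount (2 + D * n) n e
    shape = cong (λ N → dissectionCount N n e) (+-comm (D * n) 2)

  w≡trees : ∀ a b {n} → a + b ≡ n → w d n (ι a ℤ.- ι b) ≡ fromℕ (trees a b)
  w≡trees a b {n} h = trans (w≡dissectionCount n (ι a ℤ.- ι b))
    (cong fromℕ (Dissections.length-dissections m n (1 + D * n) refl {a} {b} h))

  w≡0 : ∀ {n e} → (∀ a b → a + b ≡ n → ι a ℤ.- ι b ≢ e) → w d n e ≡ 0ℚ
  w≡0 {n} {e} h = trans (w≡dissectionCount n e) (cong fromℕ (Dissections.dissections-empty m n (1 + D * n) refl {e} h))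

  -- What the k-th summand must satisfy: it accounts for b + k white cells, and `exponent` is the
  -- equation blacks - whites = base - 2 k without subtraction.
  record Coefficient (n base b : ℕ) (c : ℚ) (k : ℕ) : Set where
    field
      blacks   : ℕ
      total    : blacks + (b + k) ≡ n
      exponent : blacks + 2 * k ≡ base + (b + k)
      value    : c ≡ fromℕ (trees blacks (b + k))

  -- The exponents that can occur are n - 2 b for b white cells. Those with b from b₀ to b₀ + K
  -- match the summands one by one; outside this range the hypotheses make one of the two binomials
  -- vanish.
  w-formula : ∀ n K base b₀ (c : ℕ → ℚ) → (∀ k → k ≤ K → Coefficient n base b₀ (c k) k) →
              (∀ a b → a + b ≡ n → b < b₀ → suc (d * b) < a) → (∀ a b → a + b ≡ n → b₀ + K < b → d * a < b) →
              ∀ e → w d n e ≡ ΣL K (λ k → mono (c k) (ι base ℤ.- ι (2 * k))) e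
  w-formula n K base b₀ c coeff few many e = by-case (any? (λ k → e ℤ.≟ g k) (upTo (suc K)))
    where
    g : ℕ → ℤ
    g k = ι base ℤ.- ι (2 * k)
    g-injective : ∀ {k k′} → g k ≡ g k′ → k ≡ k′
    g-injective {k} {k′} h = sym (*-cancelˡ-≡ k′ k 2
      (+-cancelˡ-≡ base (2 * k′) (2 * k) (difference-injective {base} {2 * k} {base} {2 * k′} h)))
    hit : ∀ k → k ≤ K → w d n (g k) ≡ ΣL K (λ k → mono (c k) (g k)) (g k)
    hit k k≤K = trans (cong (w d n) (sym (difference-cong blacks (b₀ + k) base (2 * k) exponent)))
      (trans (w≡trees blacks (b₀ + k) total) (trans (sym value)
        (sym (sum-hit c g g-injective (Unique.upTo⁺ (suc K)) (∈-upTo⁺ (s≤s k≤K))))))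
      where open Coefficient (coeff k k≤K)
    vanish : (∀ k → k ≤ K → e ≢ g k) → ∀ a b → a + b ≡ n → ι a ℤ.- ι b ≡ e → trees a b ≡ 0
    vanish h a b a+b≡n ab≡e with b <? b₀ | b₀ + K <? b
    ... | yes b<b₀ | _     = trees-few-whites a b (few a b a+b≡n b<b₀)
    ... | no _ | yes K<b   = trees-many-whites a b (many a b a+b≡n K<b)
    ... | no b≮b₀ | no K≮b with k , refl ← m≤n⇒∃[o]m+o≡n (≮⇒≥ b≮b₀) = ⊥-elim (h k k≤K (trans (sym ab≡e)
          (trans (cong (λ a → ι a ℤ.- ι b) (+-cancelʳ-≡ b a blacks (trans a+b≡n (sym total))))
                 (difference-cong blacks b base (2 * k) exponent))))
      where
      k≤K = +-cancelˡ-≤ b₀ k K (≮⇒≥ K≮b)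
      open Coefficient (coeff k k≤K)
    miss : (∀ k → k ≤ K → e ≢ g k) → Dec (Any (λ b → ι (n ∸ b) ℤ.- ι b ≡ e) (upTo (suc n))) → w d n e ≡ 0ℚ
    miss h (yes any) with b , b∈ , eq ← find any =
      trans (cong (w d n) (sym eq)) (trans (w≡trees (n ∸ b) b sum) (cong fromℕ (vanish h (n ∸ b) b sum eq)))
      where
      sum : n ∸ b + b ≡ n
      sum = m∸n+n≡m (≤-pred (∈-upTo⁻ b∈))
    miss h (no none) = w≡0 λ a b a+b≡n eq → none (lose (∈-upTo⁺ (s≤s (subst (b ≤_) a+b≡n (m≤n+m b a))))
      (trans (cong (λ a → ι a ℤ.- ι b) (trans (cong (_∸ b) (sym a+b≡n)) (m+n∸n≡m a b))) eq))
    by-case : Dec (Any (λ k → e ≡ g k) (upTo (suc K))) → w d n e ≡ ΣL K (λ k → mono (c k) (g k)) e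
    by-case (yes any) with k , k∈ , refl ← find any = hit k (≤-pred (∈-upTo⁻ k∈))
    by-case (no none) = trans (miss h (any? (λ b → (ι (n ∸ b) ℤ.- ι b) ℤ.≟ e) (upTo (suc n))))
                              (sym (sum-miss c g (All.tabulate λ k∈ → h _ (≤-pred (∈-upTo⁻ k∈)))))
      where
      h : ∀ k → k ≤ K → e ≢ g k
      h k k≤K eq = none (lose (∈-upTo⁺ (s≤s k≤K)) eq)

  1+d*b<d*x : ∀ {b x} → suc b ≤ x → suc (d * b) < d * x
  1+d*b<d*x {b} {x} h = <-≤-trans (subst (suc (d * b) <_) (sym (d*suc b)) (s≤s (s≤s (m≤n+m (d * b) m)))) (*-monoʳ-≤ d h)

  formula₁ : ∀ n e → w d ((d + 1) * n) e ≡ rhs₁ d n e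
  formula₁ n = w-formula ((d + 1) * n) (D * n) (D * n) n _ coefficient few many
    where
    coefficient : ∀ k → k ≤ D * n → Coefficient ((d + 1) * n) (D * n) n
      (ι (((d * d * n ∸ d * k) C (n + k)) * ((d * (n + k)) C ((d + 1) * k))) ℚ./ suc ((d + 1) * k)) k
    coefficient k k≤ = record
      -- Here o = D n - k, so there are d n - k black and n + k white cells.
      { blacks   = o + n
      ; total    = trans (e₁ o n k) (trans (cong (λ z → z + (n + n)) k+o) (e₂ D n))
      ; exponent = trans (e₃ o n k) (cong (λ z → z + (n + k)) k+o)
      ; value    = quotient≡fromℕ ((d + 1) * k) (trees (o + n) (n + k)) (value n k o k+o) }
      where
      o = proj₁ (m≤n⇒∃[o]m+o≡n k≤)
      k+o = proj₂ (m≤n⇒∃[o]m+o≡n k≤)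
      e₁ : ∀ o n k → o + n + (n + k) ≡ k + o + (n + n)
      e₁ = solve-∀
      e₂ : ∀ D n → D * n + (n + n) ≡ (suc D + 1) * n
      e₂ = solve-∀
      e₃ : ∀ o n k → o + n + 2 * k ≡ k + o + (n + k)
      e₃ = solve-∀
      top : ∀ n k o → k + o ≡ D * n → d * d * n ∸ d * k ≡ d * (o + n)
      top n k o eq = trans (cong (_∸ d * k) (trans (t₁ D n) (trans (cong (λ z → d * (z + n)) (sym eq)) (t₂ d k o n))))
                           (m+n∸n≡m (d * (o + n)) (d * k))
        where
        t₁ : ∀ D n → suc D * suc D * n ≡ suc D * (D * n + n)
        t₁ = solve-∀
        t₂ : ∀ d k o n → d * (k + o + n) ≡ d * (o + n) + d * k
        t₂ = solve-∀
      value : ∀ n k o → k + o ≡ D * n → suc ((d + 1) * k) * trees (o + n) (n + k) ≡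
              ((d * d * n ∸ d * k) C (n + k)) * ((d * (n + k)) C ((d + 1) * k))
      -- For n = 0 the dissection is empty and has no black cell, a case outside the closed form,
      -- which presupposes a black root.
      value zero k o eq with refl ← m+n≡0⇒m≡0 k (trans eq (*-zeroʳ D)) | refl ← m+n≡0⇒n≡0 k (trans eq (*-zeroʳ D)) =
        lem (d * d * 0 ∸ d * 0) (d * 0) ((d + 1) * 0)
          (trans (cong (_∸ d * 0) (*-zeroʳ (d * d))) (0∸n≡0 (d * 0))) (*-zeroʳ d) (*-zeroʳ (d + 1))
        where
        lem : ∀ x y z → x ≡ 0 → y ≡ 0 → z ≡ 0 → suc z * 1 ≡ (x C 0) * (y C z)
        lem _ _ _ refl refl refl = refl
      value n@(suc n′) k o eq = trans (cong (λ z → suc ((d + 1) * k) * trees z (n + k)) (+-suc o n′))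
        (trans (trees-by-complement (o + n′) (n + k) ((d + 1) * k)
                 (trans (v₁ o n′ k d) (trans (cong (λ z → z + (n + d * k)) eq) (v₂ D n k))))
          (cong (λ z → (z C (n + k)) * ((d * (n + k)) C ((d + 1) * k)))
                (trans (cong (d *_) (sym (+-suc o n′))) (sym (top n k o eq)))))
        where
        v₁ : ∀ o n k d → o + n + suc ((d + 1) * k) ≡ k + o + (suc n + d * k)
        v₁ = solve-∀
        v₂ : ∀ D n k → D * n + (n + suc D * k) ≡ suc D * (n + k)
        v₂ = solve-∀
    few : ∀ a b → a + b ≡ (d + 1) * n → b < n → suc (d * b) < a
    few a b h b<n = <-≤-trans (1+d*b<d*x b<n) (+-cancelʳ-≤ b (d * n) a (begin
      d * n + b     ≤⟨ +-monoʳ-≤ (d * n) (<⇒≤ b<n) ⟩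
      d * n + n     ≡⟨ lem d n ⟩
      (d + 1) * n   ≡⟨ h ⟨
      a + b         ∎))
      where
      open ≤-Reasoning
      lem : ∀ d n → d * n + n ≡ (d + 1) * n
      lem = solve-∀
    many : ∀ a b → a + b ≡ (d + 1) * n → n + D * n < b → d * a < b
    many a b h <b = ≤-<-trans (*-monoʳ-≤ d (+-cancelʳ-≤ (d * n) a n (begin
      a + d * n     ≤⟨ +-monoʳ-≤ a (<⇒≤ <b) ⟩
      a + b         ≡⟨ h ⟩
      (d + 1) * n   ≡⟨ lem d n ⟩
      n + d * n     ∎))) <b
      where
      open ≤-Reasoning
      lem : ∀ d n → (d + 1) * n ≡ n + d * n
      lem = solve-∀

  -- The stated denominator d n + 1 - k is the number of black cells, so the closed form applies
  -- directly, with only one binomial replaced by its complement.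
  formula₂ : ∀ n e → w d ((d + 1) * n + 1) e ≡ rhs₂ d n e
  formula₂ n = w-formula ((d + 1) * n + 1) (D * n) (D * n + 1) n _ coefficient few many
    where
    coefficient : ∀ k → k ≤ D * n → Coefficient ((d + 1) * n + 1) (D * n + 1) n
      (ι (((d * d * n + d ∸ d * k) C (n + k)) * ((d * (n + k)) C ((d + 1) * k))) ℚ./ suc (d * n ∸ k)) k
    coefficient k k≤ = record
      { blacks   = suc (o + n)
      ; total    = trans (e₁ o n k) (trans (cong (λ z → z + (n + n) + 1) k+o) (e₂ D n))
      ; exponent = trans (e₃ o n k) (cong (λ z → z + 1 + (n + k)) k+o)
      ; value    = quotient≡fromℕ (d * n ∸ k) (trees (suc (o + n)) (n + k)) value }
      where
      o = proj₁ (m≤n⇒∃[o]m+o≡n k≤)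
      k+o = proj₂ (m≤n⇒∃[o]m+o≡n k≤)
      e₁ : ∀ o n k → suc (o + n) + (n + k) ≡ k + o + (n + n) + 1
      e₁ = solve-∀
      e₂ : ∀ D n → D * n + (n + n) + 1 ≡ (suc D + 1) * n + 1
      e₂ = solve-∀
      e₃ : ∀ o n k → suc (o + n) + 2 * k ≡ k + o + 1 + (n + k)
      e₃ = solve-∀
      top : d * d * n + d ∸ d * k ≡ d * suc (o + n)
      top = trans (cong (_∸ d * k) (trans (t₁ D n) (trans (cong (λ z → d * suc (z + n)) (sym k+o)) (t₂ d k o n))))
                  (m+n∸n≡m (d * suc (o + n)) (d * k))
        where
        t₁ : ∀ D n → suc D * suc D * n + suc D ≡ suc D * suc (D * n + n)
        t₁ = solve-∀
        t₂ : ∀ d k o n → d * suc (k + o + n) ≡ d * suc (o + n) + d * k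
        t₂ = solve-∀
      denominator : d * n ∸ k ≡ o + n
      denominator = trans (cong (_∸ k) (trans (cong (n +_) (sym k+o)) (t k o n))) (m+n∸n≡m (o + n) k)
        where
        t : ∀ k o n → n + (k + o) ≡ o + n + k
        t = solve-∀
      value : suc (d * n ∸ k) * trees (suc (o + n)) (n + k) ≡
              ((d * d * n + d ∸ d * k) C (n + k)) * ((d * (n + k)) C ((d + 1) * k))
      value = trans (cong (λ z → suc z * trees (suc (o + n)) (n + k)) denominator)
        (trans (trees-by-blacks (o + n) (n + k) ((d + 1) * k)
                 (trans (v₁ o n k d) (trans (cong (λ z → z + (n + d * k)) k+o) (v₂ D n k))))
          (cong (λ z → (z C (n + k)) * ((d * (n + k)) C ((d + 1) * k))) (sym top)))
        where
        v₁ : ∀ o n k d → o + n + (d + 1) * k ≡ k + o + (n + d * k)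
        v₁ = solve-∀
        v₂ : ∀ D n k → D * n + (n + suc D * k) ≡ suc D * (n + k)
        v₂ = solve-∀
    few : ∀ a b → a + b ≡ (d + 1) * n + 1 → b < n → suc (d * b) < a
    few a b h b<n = <-≤-trans (1+d*b<d*x b<n) (+-cancelʳ-≤ b (d * n) a (begin
      d * n + b       ≤⟨ +-monoʳ-≤ (d * n) (≤-trans (<⇒≤ b<n) (m≤m+n n 1)) ⟩
      d * n + (n + 1) ≡⟨ lem d n ⟩
      (d + 1) * n + 1 ≡⟨ h ⟨
      a + b           ∎))
      where
      open ≤-Reasoning
      lem : ∀ d n → d * n + (n + 1) ≡ (d + 1) * n + 1
      lem = solve-∀
    many : ∀ a b → a + b ≡ (d + 1) * n + 1 → n + D * n < b → d * a < b
    many a b h <b = ≤-<-trans (*-monoʳ-≤ d (+-cancelʳ-≤ (suc (d * n)) a n (begin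
      a + suc (d * n)   ≤⟨ +-monoʳ-≤ a <b ⟩
      a + b             ≡⟨ h ⟩
      (d + 1) * n + 1   ≡⟨ lem d n ⟩
      n + suc (d * n)   ∎))) <b
      where
      open ≤-Reasoning
      lem : ∀ d n → (d + 1) * n + 1 ≡ n + suc (d * n)
      lem = solve-∀

  -- Here j = i + 2 and t = d - j. With at most n white cells there would be at least d n + j black
  -- ones, more than the d b + 1 that b white cells allow, because j is at least 2. So the sum
  -- starts at n + 1 white cells.
  formula₃ : ∀ n i t → suc (suc i) + t ≡ d → ∀ e → w d ((d + 1) * n + suc (suc i)) e ≡ rhs₃ d n (suc (suc i)) e
  formula₃ n i t i+t e = trans (go e) (cong₂ (λ K base → ΣL K (λ k → mono (c k) (ι base ℤ.- ι (2 * k))) e) K≡ K≡)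
    where
    K≡ : D * n + i ≡ D * n + suc (suc i) ∸ 2
    K≡ = sym (cong (_∸ 2) (trans (+-suc (D * n) (suc i)) (cong suc (+-suc (D * n) i))))
    c : ℕ → ℚ
    c k = ι (((d * d * n + d * suc i ∸ d * k) C (n + 1 + k))
             * ((d * n + d + d * k) C ((d + 1) * k + (d ∸ suc (suc i)) + 1)))
          ℚ./ suc ((d + 1) * k + (d ∸ suc (suc i)) + 1)
    coefficient : ∀ k → k ≤ D * n + i → Coefficient ((d + 1) * n + suc (suc i)) (D * n + i) (n + 1) (c k) k
    coefficient k k≤ = record
      -- Now o = D n + i - k, which gives d n + j - 1 - k black and n + 1 + k white cells.
      { blacks   = suc (o + n)
      ; total    = trans (e₁ o n k) (trans (cong (λ z → z + (n + n) + 2) k+o) (e₂ D n i))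
      ; exponent = trans (e₃ o n k) (cong (λ z → z + (n + 1 + k)) k+o)
      ; value    = quotient≡fromℕ ((d + 1) * k + (d ∸ suc (suc i)) + 1) (trees (suc (o + n)) (n + 1 + k)) value }
      where
      o = proj₁ (m≤n⇒∃[o]m+o≡n k≤)
      k+o = proj₂ (m≤n⇒∃[o]m+o≡n k≤)
      e₁ : ∀ o n k → suc (o + n) + (n + 1 + k) ≡ k + o + (n + n) + 2
      e₁ = solve-∀
      e₂ : ∀ D n i → D * n + i + (n + n) + 2 ≡ (suc D + 1) * n + suc (suc i)
      e₂ = solve-∀
      e₃ : ∀ o n k → suc (o + n) + 2 * k ≡ k + o + (n + 1 + k)
      e₃ = solve-∀
      top : d * d * n + d * suc i ∸ d * k ≡ d * suc (o + n)
      top = trans (cong (_∸ d * k) (trans (t₁ D n i) (trans (cong (λ z → d * suc (z + n)) (sym k+o)) (t₂ d k o n))))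
                  (m+n∸n≡m (d * suc (o + n)) (d * k))
        where
        t₁ : ∀ D n i → suc D * suc D * n + suc D * suc i ≡ suc D * suc (D * n + i + n)
        t₁ = solve-∀
        t₂ : ∀ d k o n → d * suc (k + o + n) ≡ d * suc (o + n) + d * k
        t₂ = solve-∀
      d∸j : d ∸ suc (suc i) ≡ t
      d∸j = trans (cong (_∸ suc (suc i)) (sym i+t)) (m+n∸m≡n (suc (suc i)) t)
      complement : o + n + suc ((d + 1) * k + t + 1) ≡ d * (n + 1 + k)
      complement = trans (v₁ o n k d t) (trans (cong (λ z → z + (n + d * k) + (t + 2)) k+o)
        (trans (v₂ D n i k t) (trans (cong (λ z → d * n + d * k + z) i+t) (v₃ d n k))))
        where
        v₁ : ∀ o n k d t → o + n + suc ((d + 1) * k + t + 1) ≡ k + o + (n + d * k) + (t + 2)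
        v₁ = solve-∀
        v₂ : ∀ D n i k t → D * n + i + (n + suc D * k) + (t + 2) ≡ suc D * n + suc D * k + (suc (suc i) + t)
        v₂ = solve-∀
        v₃ : ∀ d n k → d * n + d * k + d ≡ d * (n + 1 + k)
        v₃ = solve-∀
      value : suc ((d + 1) * k + (d ∸ suc (suc i)) + 1) * trees (suc (o + n)) (n + 1 + k) ≡
              ((d * d * n + d * suc i ∸ d * k) C (n + 1 + k)) * ((d * n + d + d * k) C ((d + 1) * k + (d ∸ suc (suc i)) + 1))
      value = trans (cong (λ z → suc ((d + 1) * k + z + 1) * trees (suc (o + n)) (n + 1 + k)) d∸j)
        (trans (trees-by-complement (o + n) (n + 1 + k) ((d + 1) * k + t + 1) complement)
          (sym (trans (cong (λ z → ((d * d * n + d * suc i ∸ d * k) C (n + 1 + k))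
                                   * ((d * n + d + d * k) C ((d + 1) * k + z + 1))) d∸j)
            (cong₂ (λ x y → (x C (n + 1 + k)) * (y C ((d + 1) * k + t + 1))) top (bottom d n k)))))
        where
        bottom : ∀ d n k → d * n + d + d * k ≡ d * (n + 1 + k)
        bottom = solve-∀
    few : ∀ a b → a + b ≡ (d + 1) * n + suc (suc i) → b < n + 1 → suc (d * b) < a
    few a b h b<n+1 = ≤-trans (s≤s (s≤s (*-monoʳ-≤ d b≤n))) (+-cancelʳ-≤ b (suc (suc (d * n))) a (begin
      suc (suc (d * n)) + b        ≤⟨ +-monoʳ-≤ (suc (suc (d * n))) (≤-trans b≤n (m≤m+n n i)) ⟩
      suc (suc (d * n)) + (n + i)  ≡⟨ lem d n i ⟩
      (d + 1) * n + suc (suc i)    ≡⟨ h ⟨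
      a + b                        ∎))
      where
      open ≤-Reasoning
      b≤n : b ≤ n
      b≤n = ≤-pred (subst (b <_) (+-comm n 1) b<n+1)
      lem : ∀ d n i → suc (suc (d * n)) + (n + i) ≡ (d + 1) * n + suc (suc i)
      lem = solve-∀
    many : ∀ a b → a + b ≡ (d + 1) * n + suc (suc i) → n + 1 + (D * n + i) < b → d * a < b
    many a b h <b = ≤-<-trans (*-monoʳ-≤ d (+-cancelʳ-≤ (suc (n + 1 + (D * n + i))) a n (begin
      a + suc (n + 1 + (D * n + i))   ≤⟨ +-monoʳ-≤ a <b ⟩
      a + b                           ≡⟨ h ⟩
      (d + 1) * n + suc (suc i)       ≡⟨ lem D n i ⟩
      n + suc (n + 1 + (D * n + i))   ∎))) (≤-<-trans (subst (d * n ≤_) (lem′ D n i) (m≤m+n (d * n) (i + 1))) <b)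
      where
      open ≤-Reasoning
      lem : ∀ D n i → (suc D + 1) * n + suc (suc i) ≡ n + suc (n + 1 + (D * n + i))
      lem = solve-∀
      lem′ : ∀ D n i → suc D * n + (i + 1) ≡ n + 1 + (D * n + i)
      lem′ = solve-∀
    go : ∀ e → w d ((d + 1) * n + suc (suc i)) e ≡ ΣL (D * n + i) (λ k → mono (c k) (ι (D * n + i) ℤ.- ι (2 * k))) e
    go = w-formula ((d + 1) * n + suc (suc i)) (D * n + i) (D * n + i) (n + 1) c coefficient few many

theorem3p6 : (d : ℕ) → 2 ≤ d → d ≤ 6 → (n : ℕ) →
    (∀ e → w d ((d + 1) * n) e ≡ rhs₁ d n e)
    × (∀ e → w d ((d + 1) * n + 1) e ≡ rhs₂ d n e)
    × (∀ j → 2 ≤ j → j ≤ d → ∀ e → w d ((d + 1) * n + j) e ≡ rhs₃ d n j e)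
theorem3p6 (suc (suc m)) _ _ n = formula₁ n , formula₂ n , third
  where
  open Formula m
  third : ∀ j → 2 ≤ j → j ≤ suc (suc m) → ∀ e → w (suc (suc m)) ((suc (suc m) + 1) * n + j) e ≡ rhs₃ (suc (suc m)) n j e
  third (suc (suc i)) _ j≤d = formula₃ n i (proj₁ (m≤n⇒∃[o]m+o≡n j≤d)) (proj₂ (m≤n⇒∃[o]m+o≡n j≤d))
  third (suc zero) (s≤s ())
theorem3p6 (suc zero) (s≤s ())
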